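{- Let $r,p,s,n$ be positive integers such that $p\mid r$, $s\mid r$ and $ps\mid rn$. For $k\ge 0$ let $Q_{r/s}(k)$ be the integer determined by $k=\frac{r}{s}Q_{r/s}(k)+R_{r/s}(k)$. Then, as formal power series in $t,q,a$, $$\Bigg\{\sum_{k\geq 0}t^k\left([Q_{r/s}(k)+1]_{q^{r/s}}+aq\Big[\frac{r}{s}-1\Big]_{aq}[Q_{r/s}(k)]_{q^{r/s}}+aq^{Q_{r/s}(k)\frac{r}{s}+1}[R_{r/s}(k)]_{aq}\right)^n\Bigg\}_{q^p}$$ $$=\frac{\sum_{g\in G(r,p,s,n)}t^{\mathrm{fdes}(g)}q^{\mathrm{fmaj}(g)}a^{\mathrm{col}(g)}}{(1-t)(1-t^rq^r)(1-t^rq^{2r})\cdots(1-t^rq^{(n-1)r})(1-t^{r/s}q^{nr/s})}.$$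
   Context: Notation. For a positive integer $m$, $R_m(i)\in\{0,\ldots,m-1\}$ denotes the residue of $i\in\mathbb Z$ modulo $m$. $[m]_x=1+x+\cdots+x^{m-1}$, with $[0]_x=0$. For a power series $F$, $\{F\}_{q^p}$ is obtained from $F$ by discarding all terms whose degree in $q$ is not divisible by $p$. Groups. $G(r,n)$ is the group of pairs $(c_1,\ldots,c_n;\sigma)$ with $c_i\in\{0,\ldots,r-1\}$ (the colors) and $\sigma\in S_n$, with product $(d_1,\ldots,d_n;\tau)(c_1,\ldots,c_n;\sigma)=(R_r(c_1+d_{\sigma(1)}),\ldots,R_r(c_n+d_{\sigma(n)});\tau\sigma)$. For $p\mid r$, $G(r,p,n)$ is the subgroup of elements with $c_1+\cdots+c_n\equiv 0 \bmod p$. For $s\mid r$ with $ps\mid rn$, $C_s\subseteq G(r,p,n)$ is the cyclic subgroup of order $s$ generated by $(r/s,\ldots,r/s;\mathrm{id})$, and $G(r,p,s,n)=G(r,p,n)/C_s$. Statistics. For $g\in G(r,p,s,n)$ represented by $(c_1,\ldots,c_n;\sigma)$ let $\mathrm{HDes}(g)=\{i\in\{1,\ldots,n-1\}: c_i=c_{i+1},\ \sigma(i)>\sigma(i+1)\}$, $h_i(g)=\#\{j\ge i: j\in\mathrm{HDes}(g)\}$, $k_n(g)=R_{r/s}(c_n)$, $k_i(g)=k_{i+1}(g)+R_r(c_i-c_{i+1})$ for $1\le i\le n-1$, $\lambda_i(g)=r\,h_i(g)+k_i(g)$. Then $\mathrm{fmaj}(g)=\sum_{i=1}^n\lambda_i(g)$,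 $\mathrm{fdes}(g)=\lambda_1(g)$, $\mathrm{col}(g)=\sum_{i=1}^nR_{r/s}(c_i)$. These do not depend on the representative chosen. -}

module Defs where

open import Algebra.Bundles.Raw using (RawRing; RawMonoid)
import Algebra.Definitions.RawMonoid as RawMonoidDefs
import Algebra.Definitions.RawSemiring as RawSemiringDefs
open import Data.Bool.Base using (if_then_else_)
open import Data.Fin.Base as Fin using (Fin; zero; suc; toℕ; fromℕ<)
import Data.Fin.Properties as Fin
open import Data.Fin.Permutation as Perm using (Permutation′; _⟨$⟩ʳ_; _∘ₚ_)
open import Data.Integer.Base as ℤ using (ℤ; 0ℤ; +_)
open import Data.Integer.DivMod using (_%ℕ_)
open import Data.List.Base as List
  using (List; []; _∷_; allFin; filter; length; cartesianProductWith; deduplicate)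
import Data.List.Membership.Setoid as Membership
open import Data.List.Membership.Setoid.Properties
  using (∈-cartesianProductWith⁺)
open import Data.List.Membership.Propositional.Properties using (∈-allFin)
open import Data.List.Relation.Unary.Any using (here; there)
open import Data.List.Relation.Unary.Enumerates.Setoid using (IsEnumeration)
open import Data.List.Relation.Unary.Enumerates.Setoid.Properties using (deduplicate⁺)
open import Data.List.Relation.Unary.Unique.DecSetoid.Properties using (deduplicate-!)
import Data.List.Relation.Unary.Unique.Setoid as Unique
open import Data.Nat.Base as ℕ using (ℕ; zero; suc; NonZero; _∸_; _/_; _%_)
open import Data.Nat.DivMod
open import Data.Nat.Divisibility using (_∣_; _∣?_; ∣⇒≤)
import Data.Nat.Properties as ℕ
open import Data.Nat.Tactic.RingSolver using (solve-∀)
open import Data.Product.Base using (_×_; _,_; ∃)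
open import Data.Vec.Functional as Vector using (Vector; head; tail)
open import Function.Base using (_∘_)
open import Level using (0ℓ)
open import Relation.Binary.Bundles using (Setoid; DecSetoid)
open import Relation.Binary.Core using (Rel)
open import Relation.Binary.Definitions using (Decidable; Reflexive; Symmetric; Transitive)
open import Relation.Binary.PropositionalEquality
  using (_≡_; refl; sym; trans; cong; cong₂; subst; setoid; module ≡-Reasoning)
open import Relation.Nullary.Decidable
  using (Dec; yes; no; does; _×-dec_; map′)
open import Relation.Nullary.Negation using (contradiction)
open import Relation.Unary using (Pred)

open RawMonoidDefs ℕ.+-0-rawMonoid public using () renaming (sum to sumℕ)

------------------------------------------------------------------------
-- Formal power series

module _ {c ℓ} (R : RawRing c ℓ) where
  open RawRing R using () renaming
    (Carrier to A; _≈_ to _≈ᴿ_; _+_ to _+ᴿ_; _*_ to _*ᴿ_; -_ to -ᴿ_; 0# to 0ᴿ; 1# to 1ᴿ)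
  open RawSemiringDefs (RawRing.rawSemiring R) using (sum)

  constant : A → (ℕ → A)
  constant x zero    = x
  constant x (suc _) = 0ᴿ

  -- A series in R[[x]] is the function sending k to the coefficient of xᵏ.
  PowerSeries : RawRing c ℓ
  PowerSeries = record
    { Carrier = ℕ → A
    ; _≈_     = λ F G → ∀ k → F k ≈ᴿ G k
    ; _+_     = λ F G k → F k +ᴿ G k
    ; _*_     = λ F G k → sum {suc k} (λ i → F (toℕ i) *ᴿ G (k ∸ toℕ i))
    ; -_      = λ F k → -ᴿ F k
    ; 0#      = λ _ → 0ᴿ
    ; 1#      = constant 1ᴿ
    }

  indeterminate : ℕ → A
  indeterminate (suc zero) = 1ᴿ
  indeterminate _          = 0ᴿ

  -- The sum of a family in which F k is divisible by xᵏ, so that only the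
  -- terms with k ≤ m contribute to the coefficient of xᵐ.
  infiniteSum : (ℕ → (ℕ → A)) → (ℕ → A)
  infiniteSum F m = sum {suc m} (λ k → F (toℕ k) m)

ℤ[[a]] ℤ[[q,a]] ℤ[[t,q,a]] : RawRing 0ℓ 0ℓ
ℤ[[a]]     = PowerSeries ℤ.+-*-rawRing
ℤ[[q,a]]   = PowerSeries ℤ[[a]]
ℤ[[t,q,a]] = PowerSeries ℤ[[q,a]]

-- For F : Series, F i j l is the coefficient of tⁱqʲaˡ.
Series : Set
Series = RawRing.Carrier ℤ[[t,q,a]]

t q a : Series
t = indeterminate ℤ[[q,a]]
q = constant ℤ[[q,a]] (indeterminate ℤ[[a]])
a = constant ℤ[[q,a]] (constant ℤ[[a]] (indeterminate ℤ.+-*-rawRing))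

module SeriesOperations where
  open RawRing ℤ[[t,q,a]] public using (_≈_; _+_; _*_; -_; 0#; 1#)
  open RawSemiringDefs (RawRing.rawSemiring ℤ[[t,q,a]]) public using (_^_; sum; product)

  infixl 6 _-_
  _-_ : Series → Series → Series
  F - G = F + - G

  -- Σ_{k ≥ 0} F k, for F k divisible by tᵏ.
  ∑∞ : (ℕ → Series) → Series
  ∑∞ = infiniteSum ℤ[[q,a]]

  -- Division by a series D with D ≡ 1 mod t: 1/D = Σ_{k ≥ 0} (1 - D)ᵏ.
  infixl 7 _÷_
  _÷_ : Series → Series → Series
  F ÷ D = F * ∑∞ (λ k → (1# - D) ^ k)

  [_]⟨_⟩ : ℕ → Series → Series
  [ m ]⟨ x ⟩ = sum {m} (λ i → x ^ toℕ i)

  ⟪_⟫q^_ : Series → ℕ → Series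
  (⟪ F ⟫q^ p) i j l = if does (p ∣? j) then F i j l else 0ℤ

  ∑∈ : ∀ {b} {B : Set b} → List B → (B → Series) → Series
  ∑∈ xs f = List.foldr (λ x F → f x + F) 0# xs

  syntax ∑∈ xs (λ x → F) = ∑[ x ∈ xs ] F

------------------------------------------------------------------------
-- G(r,n)

open import Data.Nat.Base using (_+_; _*_)

-- Positions 1,…,n are represented by Fin n, so toℕ i is one less than the
-- position it stands for.
record ColouredPerm (r n : ℕ) : Set where
  constructor _⨾_
  field
    colour : Vector (Fin r) n
    perm   : Permutation′ n

open ColouredPerm public

module _ {r n : ℕ} where

  infix 4 _≋_
  _≋_ : Rel (ColouredPerm r n) 0ℓ
  g ≋ h = (∀ i → colour g i ≡ colour h i) × perm g Perm.≈ perm h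

  -- _∘ₚ_ composes in diagrammatic order, so σ ∘ₚ τ is the product τσ.
  _∙_ : .{{NonZero r}} → ColouredPerm r n → ColouredPerm r n → ColouredPerm r n
  (d ⨾ τ) ∙ (c ⨾ σ) =
    (λ i → (toℕ (c i) + toℕ (d (σ ⟨$⟩ʳ i))) mod r) ⨾ (σ ∘ₚ τ)

  identity : .{{NonZero r}} → ColouredPerm r n
  identity = (λ _ → 0 mod r) ⨾ Perm.id

rawMonoid : (r n : ℕ) .{{_ : NonZero r}} → RawMonoid 0ℓ 0ℓ
rawMonoid r n = record
  { Carrier = ColouredPerm r n ; _≈_ = _≋_ ; _∙_ = _∙_ ; ε = identity }

private

  ≋-decSetoid : (r n : ℕ) → DecSetoid 0ℓ 0ℓ
  ≋-decSetoid r n = record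
    { Carrier = ColouredPerm r n
    ; _≈_ = _≋_
    ; isDecEquivalence = record
      { isEquivalence = record
        { refl  = (λ _ → refl) , (λ _ → refl)
        ; sym   = λ (e , f) → (λ i → sym (e i)) , (λ i → sym (f i))
        ; trans = λ (e , f) (e′ , f′) →
            (λ i → trans (e i) (e′ i)) , (λ i → trans (f i) (f′ i))
        }
      ; _≟_ = λ g h →
          Fin.all? (λ i → colour g i Fin.≟ colour h i) ×-dec
          Fin.all? (λ i → (perm g ⟨$⟩ʳ i) Fin.≟ (perm h ⟨$⟩ʳ i))
      }
    }

  ≋-setoid : (r n : ℕ) → Setoid 0ℓ 0ℓ
  ≋-setoid r n = DecSetoid.setoid (≋-decSetoid r n)

  vectorSetoid : (r n : ℕ) → Setoid 0ℓ 0ℓ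
  vectorSetoid r n = record
    { Carrier = Vector (Fin r) n
    ; _≈_ = λ c d → ∀ i → c i ≡ d i
    ; isEquivalence = record
      { refl = λ _ → refl
      ; sym = λ e i → sym (e i)
      ; trans = λ e f i → trans (e i) (f i)
      }
    }

  permSetoid : (n : ℕ) → Setoid 0ℓ 0ℓ
  permSetoid n = record
    { Carrier = Permutation′ n
    ; _≈_ = Perm._≈_
    ; isEquivalence = record
      { refl = λ _ → refl
      ; sym = λ e i → sym (e i)
      ; trans = λ e f i → trans (e i) (f i)
      }
    }

  vectors : (r n : ℕ) → List (Vector (Fin r) n)
  vectors r zero    = (λ ()) ∷ []
  vectors r (suc n) = cartesianProductWith Vector._∷_ (allFin r) (vectors r n)

  perms : (n : ℕ) → List (Permutation′ n)
  perms zero    = Perm.id ∷ []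
  perms (suc n) = cartesianProductWith (Perm.insert zero) (allFin (suc n)) (perms n)

  colouredPerms : (r n : ℕ) → List (ColouredPerm r n)
  colouredPerms r n = cartesianProductWith _⨾_ (vectors r n) (perms n)

  vectors-enum : ∀ r n → IsEnumeration (vectorSetoid r n) (vectors r n)
  vectors-enum r zero    c = here λ ()
  vectors-enum r (suc n) c = subst∈ (∈-cartesianProductWith⁺
      (setoid (Fin r)) (vectorSetoid r n) S
      (λ { refl e zero → refl ; refl e (suc i) → e i })
      (∈-allFin (head c)) (vectors-enum r n (tail c)))
    where
    S = vectorSetoid r (suc n)
    open Membership S using (_∈_)
    open import Data.List.Membership.Setoid.Properties using (∈-resp-≈)
    subst∈ : (head c Vector.∷ tail c) ∈ vectors r (suc n) → c ∈ vectors r (suc n)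
    subst∈ = ∈-resp-≈ S (λ { zero → refl ; (suc i) → refl })

  insert-cong : ∀ {n} (i j : Fin (suc n)) {π ρ : Permutation′ n} → π Perm.≈ ρ →
                Perm.insert i j π Perm.≈ Perm.insert i j ρ
  insert-cong i j e k with i Fin.≟ k
  ... | yes _ = refl
  ... | no  _ = cong (Fin.punchIn j) (e _)

  perms-enum : ∀ n → IsEnumeration (permSetoid n) (perms n)
  perms-enum zero    π = here λ ()
  perms-enum (suc n) π = ∈-resp-≈ S
      {x = Perm.insert zero (π ⟨$⟩ʳ zero) (Perm.remove zero π)} {y = π}
      (Perm.insert-remove zero π)
      (∈-cartesianProductWith⁺ (setoid (Fin (suc n))) (permSetoid n) S
        (λ { {j} {_} {π} {ρ} refl e → insert-cong zero j {π} {ρ} e })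
        (∈-allFin (π ⟨$⟩ʳ zero)) (perms-enum n (Perm.remove zero π)))
    where
    S = permSetoid (suc n)
    open import Data.List.Membership.Setoid.Properties using (∈-resp-≈)

  colouredPerms-enum : ∀ r n → IsEnumeration (≋-setoid r n) (colouredPerms r n)
  colouredPerms-enum r n (c ⨾ σ) =
    ∈-cartesianProductWith⁺ (vectorSetoid r n) (permSetoid n) (≋-setoid r n)
      {f = _⨾_} (λ e f → e , f) {a = c} {b = σ} (vectors-enum r n c) (perms-enum n σ)

------------------------------------------------------------------------
-- G(r,p,n), G(r,p,s,n) and their statistics

r/s≢0 : ∀ r s .{{_ : NonZero r}} .{{_ : NonZero s}} → s ∣ r → NonZero (r / s)
r/s≢0 r s s∣r = ℕ.>-nonZero (m≥n⇒m/n>0 (∣⇒≤ s∣r))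

module ColouredPermutationGroups
  (r p s n : ℕ) .{{r≢0 : NonZero r}} .{{s≢0 : NonZero s}}
  .{{n≢0 : NonZero n}} (s∣r : s ∣ r)
  where

  private instance
    d≢0 : NonZero (r / s)
    d≢0 = r/s≢0 r s s∣r

  Q R : ℕ → ℕ
  Q k = k / (r / s)
  R k = k % (r / s)

  record G[r,p,n] : Set where
    constructor _,_
    field
      element   : ColouredPerm r n
      p∣colours : p ∣ sumℕ (toℕ ∘ colour element)

  open G[r,p,n] public

  open RawMonoidDefs (rawMonoid r n) using () renaming (_×_ to _times_)

  generator : ColouredPerm r n
  generator = (λ _ → (r / s) mod r) ⨾ Perm.id

  generator^ : ℕ → ColouredPerm r n
  generator^ j = j times generator

  -- Equality of the cosets g C_s and h C_s.
  infix 4 _∼_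
  _∼_ : Rel G[r,p,n] 0ℓ
  g ∼ h = ∃ λ j → element h ≋ element g ∙ generator^ j

  private

    d : ℕ
    d = r / s

    s*d≡r : s * d ≡ r
    s*d≡r = m*[n/m]≡n s∣r

    toℕ-mod : ∀ m → toℕ (m mod r) ≡ m % r
    toℕ-mod m = Fin.toℕ-fromℕ< (m%n<n m r)

    %-absorbˡ : ∀ x y → (x % r + y) % r ≡ (x + y) % r
    %-absorbˡ x y = begin
      (x % r + y) % r             ≡⟨ %-distribˡ-+ (x % r) y r ⟩
      (x % r % r + y % r) % r     ≡⟨ cong (λ z → (z + y % r) % r) (m%n%n≡m%n x r) ⟩
      (x % r + y % r) % r         ≡⟨ %-distribˡ-+ x y r ⟨
      (x + y) % r                 ∎
      where open ≡-Reasoning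

    %-absorbʳ : ∀ x y → (x + y % r) % r ≡ (x + y) % r
    %-absorbʳ x y = begin
      (x + y % r) % r   ≡⟨ cong (_% r) (ℕ.+-comm x (y % r)) ⟩
      (y % r + x) % r   ≡⟨ %-absorbˡ y x ⟩
      (y + x) % r       ≡⟨ cong (_% r) (ℕ.+-comm y x) ⟩
      (x + y) % r       ∎
      where open ≡-Reasoning

    generator^-perm : ∀ j i → perm (generator^ j) ⟨$⟩ʳ i ≡ i
    generator^-perm zero    i = refl
    generator^-perm (suc j) i = generator^-perm j i

    generator^-colour : ∀ j i → toℕ (colour (generator^ j) i) ≡ (j * d) % r
    generator^-colour zero    i = toℕ-mod 0
    generator^-colour (suc j) i = begin
      toℕ (colour (generator^ (suc j)) i)
        ≡⟨ toℕ-mod _ ⟩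
      (toℕ (colour (generator^ j) i) + toℕ (d mod r)) % r
        ≡⟨ cong₂ (λ x y → (x + y) % r) (generator^-colour j i) (toℕ-mod d) ⟩
      ((j * d) % r + d % r) % r
        ≡⟨ %-distribˡ-+ (j * d) d r ⟨
      (j * d + d) % r
        ≡⟨ cong (_% r) (ℕ.+-comm (j * d) d) ⟩
      (suc j * d) % r ∎
      where open ≡-Reasoning

    ∙-generator^-colour : ∀ g j i →
      toℕ (colour (g ∙ generator^ j) i) ≡ (toℕ (colour g i) + j * d) % r
    ∙-generator^-colour g j i = begin
      toℕ (colour (g ∙ generator^ j) i)
        ≡⟨ toℕ-mod _ ⟩
      (toℕ (colour (generator^ j) i) + toℕ (colour g (perm (generator^ j) ⟨$⟩ʳ i))) % r
        ≡⟨ cong₂ (λ x y → (x + toℕ (colour g y)) % r)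
             (generator^-colour j i) (generator^-perm j i) ⟩
      ((j * d) % r + toℕ (colour g i)) % r
        ≡⟨ %-absorbˡ (j * d) _ ⟩
      (j * d + toℕ (colour g i)) % r
        ≡⟨ cong (_% r) (ℕ.+-comm (j * d) _) ⟩
      (toℕ (colour g i) + j * d) % r ∎
      where open ≡-Reasoning

    Shifted : ColouredPerm r n → ℕ → ColouredPerm r n → Set
    Shifted g j h = (∀ i → toℕ (colour h i) ≡ (toℕ (colour g i) + j * d) % r)
                  × perm h Perm.≈ perm g

    to-shifted : ∀ g j h → h ≋ g ∙ generator^ j → Shifted g j h
    to-shifted g j h (e , f) =
      (λ i → trans (cong toℕ (e i)) (∙-generator^-colour g j i)) ,
      (λ i → trans (f i) (cong (perm g ⟨$⟩ʳ_) (generator^-perm j i)))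

    from-shifted : ∀ g j h → Shifted g j h → h ≋ g ∙ generator^ j
    from-shifted g j h (e , f) =
      (λ i → Fin.toℕ-injective (trans (e i) (sym (∙-generator^-colour g j i)))) ,
      (λ i → trans (f i) (cong (perm g ⟨$⟩ʳ_) (sym (generator^-perm j i))))

    toℕ%r : (x : Fin r) → toℕ x % r ≡ toℕ x
    toℕ%r x = m<n⇒m%n≡m (Fin.toℕ<n x)

    shift-by-multiple : ∀ x m → (x + m * s * d) % r ≡ x % r
    shift-by-multiple x m = begin
      (x + m * s * d) % r    ≡⟨ cong (λ y → (x + y) % r) (ℕ.*-assoc m s d) ⟩
      (x + m * (s * d)) % r  ≡⟨ cong (λ y → (x + m * y) % r) s*d≡r ⟩
      (x + m * r) % r        ≡⟨ [m+kn]%n≡m%n x m r ⟩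
      x % r                  ∎
      where open ≡-Reasoning

    reduce : ∀ x j → (x + j * d) % r ≡ (x + (j % s) * d) % r
    reduce x j = begin
      (x + j * d) % r
        ≡⟨ cong (λ y → (x + y * d) % r) (m≡m%n+[m/n]*n j s) ⟩
      (x + (j % s + j / s * s) * d) % r
        ≡⟨ cong (_% r) (arith x (j % s) (j / s * s) d) ⟩
      (x + (j % s) * d + j / s * s * d) % r
        ≡⟨ shift-by-multiple (x + (j % s) * d) (j / s) ⟩
      (x + (j % s) * d) % r ∎
      where
      open ≡-Reasoning
      arith : ∀ x u v w → x + (u + v) * w ≡ x + u * w + v * w
      arith = solve-∀

    ∼-refl : Reflexive _∼_
    ∼-refl {g , _} = 0 , from-shifted g 0 g
      ((λ i → sym (trans (cong (_% r) (ℕ.+-identityʳ _)) (toℕ%r (colour g i)))) , λ _ → refl)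

    ∼-sym : Symmetric _∼_
    ∼-sym {g , _} {h , _} (j , e) with to-shifted g j h e
    ... | e₁ , e₂ = j * ℕ.pred s , from-shifted h (j * ℕ.pred s) g
      ((λ i → sym (begin
          (toℕ (colour h i) + j * ℕ.pred s * d) % r
            ≡⟨ cong (λ y → (y + j * ℕ.pred s * d) % r) (e₁ i) ⟩
          ((toℕ (colour g i) + j * d) % r + j * ℕ.pred s * d) % r
            ≡⟨ %-absorbˡ (toℕ (colour g i) + j * d) _ ⟩
          (toℕ (colour g i) + j * d + j * ℕ.pred s * d) % r
            ≡⟨ cong (_% r) (arith (toℕ (colour g i)) j (ℕ.pred s) d) ⟩
          (toℕ (colour g i) + j * suc (ℕ.pred s) * d) % r
            ≡⟨ cong (λ y → (toℕ (colour g i) + j * y * d) % r) (ℕ.suc-pred s) ⟩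
          (toℕ (colour g i) + j * s * d) % r
            ≡⟨ shift-by-multiple _ j ⟩
          toℕ (colour g i) % r
            ≡⟨ toℕ%r (colour g i) ⟩
          toℕ (colour g i) ∎)) ,
       (λ i → sym (e₂ i)))
      where
      open ≡-Reasoning
      arith : ∀ x j s d → x + j * d + j * s * d ≡ x + j * suc s * d
      arith = solve-∀

    ∼-trans : Transitive _∼_
    ∼-trans {g , _} {h , _} {k , _} (j , e) (j′ , e′)
      with to-shifted g j h e | to-shifted h j′ k e′
    ... | e₁ , e₂ | e₁′ , e₂′ = j + j′ , from-shifted g (j + j′) k
      ((λ i → begin
          toℕ (colour k i)
            ≡⟨ e₁′ i ⟩
          (toℕ (colour h i) + j′ * d) % r
            ≡⟨ cong (λ y → (y + j′ * d) % r) (e₁ i) ⟩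
          ((toℕ (colour g i) + j * d) % r + j′ * d) % r
            ≡⟨ %-absorbˡ (toℕ (colour g i) + j * d) _ ⟩
          (toℕ (colour g i) + j * d + j′ * d) % r
            ≡⟨ cong (_% r) (arith (toℕ (colour g i)) j j′ d) ⟩
          (toℕ (colour g i) + (j + j′) * d) % r ∎) ,
       (λ i → trans (e₂′ i) (e₂ i)))
      where
      open ≡-Reasoning
      arith : ∀ x j j′ d → x + j * d + j′ * d ≡ x + (j + j′) * d
      arith = solve-∀

    infix 4 _∼?_
    _∼?_ : Decidable _∼_
    (g , _) ∼? (h , _) = map′
      (λ (j , e) → toℕ j , e)
      (λ (j , e) → j mod s , bound j e)
      (Fin.any? λ j → DecSetoid._≟_ (≋-decSetoid r n) h (g ∙ generator^ (toℕ j)))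
      where
      bound : ∀ j → h ≋ g ∙ generator^ j → h ≋ g ∙ generator^ (toℕ (j mod s))
      bound j e rewrite Fin.toℕ-fromℕ< (m%n<n j s) with to-shifted g j h e
      ... | e₁ , e₂ = from-shifted g (j % s) h
        ((λ i → trans (e₁ i) (reduce (toℕ (colour g i)) j)) , e₂)

  G[r,p,s,n] : DecSetoid 0ℓ 0ℓ
  G[r,p,s,n] = record
    { Carrier = G[r,p,n]
    ; _≈_ = _∼_
    ; isDecEquivalence = record
      { isEquivalence = record
        { refl  = λ {g} → ∼-refl {g}
        ; sym   = λ {g} {h} → ∼-sym {g} {h}
        ; trans = λ {g} {h} {k} → ∼-trans {g} {h} {k}
        }
      ; _≟_ = _∼?_
      }
    }

  private

    restrict : List (ColouredPerm r n) → List G[r,p,n]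
    restrict []       = []
    restrict (g ∷ gs) with p ∣? sumℕ (toℕ ∘ colour g)
    ... | yes p∣ = (g , p∣) ∷ restrict gs
    ... | no  _  = restrict gs

    sumℕ-cong : ∀ {m} {u v : Vector ℕ m} → (∀ i → u i ≡ v i) → sumℕ u ≡ sumℕ v
    sumℕ-cong {zero}  e = refl
    sumℕ-cong {suc m} e = cong₂ _+_ (e zero) (sumℕ-cong (λ i → e (suc i)))

    open Membership (DecSetoid.setoid G[r,p,s,n]) using () renaming (_∈_ to _∈∼_)
    open Membership (≋-setoid r n) using () renaming (_∈_ to _∈≋_)

    restrict-∈ : ∀ g {gs} → element g ∈≋ gs → g ∈∼ restrict gs
    restrict-∈ g {h ∷ gs} (here (e , f)) with p ∣? sumℕ (toℕ ∘ colour h)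
    ... | yes _ = here (0 , from-shifted (element g) 0 h
      ((λ i → trans (cong toℕ (sym (e i)))
                (sym (trans (cong (_% r) (ℕ.+-identityʳ _)) (toℕ%r (colour (element g) i)))))
      , λ i → sym (f i)))
    ... | no ∤ = contradiction
      (subst (p ∣_) (sumℕ-cong (λ i → cong toℕ (e i))) (p∣colours g)) ∤
    restrict-∈ g {h ∷ gs} (there g∈) with p ∣? sumℕ (toℕ ∘ colour h)
    ... | yes _ = there (restrict-∈ g g∈)
    ... | no  _ = restrict-∈ g g∈

  -- One representative of each element of G(r,p,s,n), as the two lemmas
  -- below certify; summing over G(r,p,s,n) means summing over this list.
  representatives : List G[r,p,n]
  representatives = deduplicate _∼?_ (restrict (colouredPerms r n))

  representatives-complete :
    IsEnumeration (DecSetoid.setoid G[r,p,s,n]) representatives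
  representatives-complete = deduplicate⁺ G[r,p,s,n]
    (λ g → restrict-∈ g (colouredPerms-enum r n (element g)))

  representatives-unique : Unique.Unique (DecSetoid.setoid G[r,p,s,n]) representatives
  representatives-unique = deduplicate-! G[r,p,s,n] _

  -- The existential picks out the position i + 1; there is none when i is
  -- the last position.
  HDes : G[r,p,n] → Pred (Fin n) 0ℓ
  HDes (c ⨾ σ , _) i = ∃ λ i⁺ →
    toℕ i⁺ ≡ suc (toℕ i) × c i ≡ c i⁺ × (σ ⟨$⟩ʳ i) Fin.> (σ ⟨$⟩ʳ i⁺)

  HDes? : ∀ g i → Dec (HDes g i)
  HDes? (c ⨾ σ , _) i = Fin.any? λ i⁺ →
    (toℕ i⁺ ℕ.≟ suc (toℕ i)) ×-dec (c i Fin.≟ c i⁺) ×-dec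
    ((σ ⟨$⟩ʳ i⁺) Fin.<? (σ ⟨$⟩ʳ i))

  h : G[r,p,n] → Fin n → ℕ
  h g i = length (filter (λ j → (i Fin.≤? j) ×-dec HDes? g j) (allFin n))

  -- k_i for a colour vector, by recursion from the last position down.
  colourSteps : ∀ {m} → Vector (Fin r) m → Vector ℕ m
  colourSteps {suc zero}    c zero    = R (toℕ (c zero))
  colourSteps {suc (suc m)} c zero    =
    colourSteps (tail c) zero + (+ toℕ (c zero) ℤ.- + toℕ (c (suc zero))) %ℕ r
  colourSteps {suc (suc m)} c (suc i) = colourSteps (tail c) i

  k : G[r,p,n] → Fin n → ℕ
  k g = colourSteps (colour (element g))

  Λ : G[r,p,n] → Fin n → ℕ
  Λ g i = r * h g i + k g i

  fmaj fdes col : G[r,p,n] → ℕ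
  fmaj g = sumℕ (Λ g)
  fdes g = Λ g (fromℕ< (ℕ.>-nonZero⁻¹ n))
  col g  = sumℕ (R ∘ toℕ ∘ colour (element g))

{-# OPTIONS --safe #-}
-- Since the base of the n-th power is Σ_{0 ≤ f ≤ k} q^f a^{R(f)}, the coefficient of t^k on the left enumerates the
-- f ∈ {0,…,k}ⁿ by q^{|f|} a^{Σ R(fᵢ)}.  Sort f into decreasing order by the permutation σ that breaks ties by
-- increasing position, and colour position i by f(σ i) mod r.  This attaches to f a single class g of G(r,1,s,n),
-- which lies in G(r,p,s,n) exactly when p divides |f|.  The f attached to g are those for which f ∘ σ = λ(g) + μ
-- with μ₁ ≥ … ≥ μₙ, the differences μᵢ - μᵢ₊₁ divisible by r and μₙ divisible by r/s.  Building μ up from its last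
-- entry, the substitution t ↦ tq adds an entry and 1/(1 - t^r) enlarges it, so that summing over μ gives the
-- denominator.
module Submission where

open import Algebra.Bundles using (CommutativeRing)
open import Algebra.Bundles.Raw using (RawRing)
open import Algebra.Morphism.Structures using (module RingMorphisms)
import Algebra.Properties.AbelianGroup as AbelianGroupProperties
import Algebra.Properties.CommutativeMonoid.Sum as MonoidSum
import Algebra.Properties.CommutativeSemiring.Exp as Exp
import Algebra.Properties.Ring as RingProperties
import Algebra.Properties.Semiring.Sum as SemiringSum
import Algebra.Solver.Ring.NaturalCoefficients.Default as SemiringSolver
open import Algebra.Structures using (IsCommutativeRing)
open import Data.Bool.Base using (if_then_else_; true; false)
open import Data.Fin.Base as Fin
  using (Fin; zero; suc; toℕ; punchIn; combine; finToFun; funToFin; _↑ˡ_; _↑ʳ_)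
open import Data.Fin.Permutation as Perm using (Permutation′; permutation; _⟨$⟩ʳ_; _⟨$⟩ˡ_)
import Data.Fin.Properties as Fin
open import Data.Integer.Base as ℤ using (0ℤ) renaming (+_ to pos; -[1+_] to negsuc)
open import Data.Integer.DivMod using (_%ℕ_; _/ℕ_; n%ℕd<d; a≡a%ℕn+[a/ℕn]*n)
import Data.Integer.Properties as ℤ
import Data.Integer.Tactic.RingSolver as ℤ-Solver
open import Data.List.Base using (List; []; _∷_; foldr; length; filter; tabulate; allFin)
open import Data.List.Relation.Unary.All as All using (All; []; _∷_)
open import Data.List.Relation.Unary.AllPairs.Core using (AllPairs; []; _∷_)
open import Data.List.Relation.Unary.Any as Any using (Any; here; there)
open import Data.Nat.Base as ℕ using (ℕ; zero; suc; NonZero; _∸_; _/_; _%_)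
open import Data.Nat.DivMod
  using (m≡m%n+[m/n]*n; m%n<n; m<n⇒m%n≡m; [m+kn]%n≡m%n; m*[n/m]≡n; _mod_)
open import Data.Nat.Divisibility as ∣ using (_∣_; _∣?_; divides)
import Data.Nat.Properties as ℕ
open import Data.Nat.Tactic.RingSolver using (solve-∀)
open import Data.Product.Base using (_×_; _,_; ∃; proj₁; proj₂)
open import Data.Sum.Base using (_⊎_; inj₁; inj₂; [_,_]′)
open import Data.Vec.Functional as Vector using (Vector; tail; head)
open import Function.Base using (_∘_)
open import Function.Bundles using (_⇔_; mk⇔; module Equivalence)
open import Relation.Binary.Definitions using (tri<; tri≈; tri>)
open import Relation.Binary.PropositionalEquality as ≡ using (_≡_; _≢_; _≗_)
import Relation.Binary.Reasoning.Setoid as SetoidReasoning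
open import Relation.Nullary.Decidable
  using (Dec; yes; no; does; dec-true; dec-false; does-⇔; _×-dec_)
open import Relation.Nullary.Negation using (¬_; contradiction)
open import Defs using (sumℕ; _⨾_; _∙_; colour; perm; r/s≢0; module ColouredPermutationGroups)

-- λ(g) is the least sequence that fits the colours and order of g: a difference of consecutive
-- terms must have the residue modulo r given by the colours, and it is raised from 0 to r exactly
-- where equal colours would allow a tie that the positions forbid. This is why a descent counts
-- only between equal colours. The coset ambiguity is absorbed by μₙ: a common shift of all entries
-- by a multiple of r/s only changes the representative, so the differences see r while the last
-- entry sees r/s. Modulo p, |f| is therefore the colour sum plus a multiple of nr/s, and p divides
-- nr/s because ps divides rn. The factor 1/(1 - t) is the bound f ≤ k, which concerns only the
-- largest entry. Up to the last step each series is described by its product with a denominator; a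
-- reciprocal is taken once, where the denominator is known to be 1 modulo t. Colour arithmetic
-- stays in ℕ, so the negative of a multiple jr/s modulo r is written as j(s - 1)r/s.

-- Indicators, finite sums and geometric series in a commutative ring.

module RingLemmas {c ℓ} (S : CommutativeRing c ℓ) where
  open CommutativeRing S public hiding (zero)
  open Exp commutativeSemiring public
    using (_^_; ^-homo-*; ^-assocʳ; ^-congˡ; ^-congʳ; ^-distrib-*)
  open RingProperties ring public using (x[y-z]≈xy-xz; -‿distribʳ-*)
  open AbelianGroupProperties +-abelianGroup public using (xyx⁻¹≈y; ⁻¹-anti-homo‿-)
  open SemiringSum semiring public
    using (sum; sum-cong-≋; sum-init-last; sum-replicate-zero; ∑-distrib-+; sum-permute
          ; *-distribˡ-sum; *-distribʳ-sum)
  open MonoidSum *-commutativeMonoid public using () renaming (sum to product; sum-cong-≋ to product-cong; sum-permute to product-permute)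
  module Solver = SemiringSolver commutativeSemiring
  open SetoidReasoning setoid

  -‿congˡ : ∀ {x y z} → x ≈ y → z - x ≈ z - y
  -‿congˡ e = +-congˡ (-‿cong e)

  ⟦_⟧ : ∀ {a} {P : Set a} → Dec P → Carrier
  ⟦ P? ⟧ = if does P? then 1# else 0#

  module _ {a} {P : Set a} (P? : Dec P) where

    ⟦⟧-yes : P → ⟦ P? ⟧ ≡ 1#
    ⟦⟧-yes p rewrite dec-true P? p = ≡.refl

    ⟦⟧-no : ¬ P → ⟦ P? ⟧ ≡ 0#
    ⟦⟧-no ¬p rewrite dec-false P? ¬p = ≡.refl

    ⟦⟧-⇔ : ∀ {b} {Q : Set b} → P ⇔ Q → (Q? : Dec Q) → ⟦ P? ⟧ ≡ ⟦ Q? ⟧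
    ⟦⟧-⇔ P⇔Q Q? = ≡.cong (if_then 1# else 0#) (does-⇔ P⇔Q P? Q?)

  ⟦⟧-*-cong : ∀ {a} {P : Set a} (P? : Dec P) {x y} → (P → x ≈ y) → ⟦ P? ⟧ * x ≈ ⟦ P? ⟧ * y
  ⟦⟧-*-cong (yes p) x≈y = *-congˡ (x≈y p)
  ⟦⟧-*-cong (no  _) x≈y = trans (zeroˡ _) (sym (zeroˡ _))

  ⟦⟧-× : ∀ {a b} {P : Set a} {Q : Set b} (P? : Dec P) (Q? : Dec Q) → ⟦ P? ×-dec Q? ⟧ ≈ ⟦ P? ⟧ * ⟦ Q? ⟧
  ⟦⟧-× (yes _) Q? = sym (*-identityˡ _)
  ⟦⟧-× (no _)  Q? = sym (zeroˡ _)

  sum-zero : ∀ {n} {f : Fin n → Carrier} → (∀ i → f i ≈ 0#) → sum f ≈ 0#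
  sum-zero {n} e = trans (sum-cong-≋ e) (sum-replicate-zero n)

  sumUpTo : ℕ → (ℕ → Carrier) → Carrier
  sumUpTo n f = sum {n} (f ∘ toℕ)

  sumUpTo-suc : ∀ n f → sumUpTo (suc n) f ≈ sumUpTo n f + f n
  sumUpTo-suc n f = trans (sum-init-last (f ∘ toℕ))
    (+-cong (sum-cong-≋ {n} (λ i → reflexive (≡.cong f (Fin.toℕ-inject₁ i))))
            (reflexive (≡.cong f (Fin.toℕ-fromℕ n))))

  sumUpTo-cong : ∀ n {f g} → (∀ i → i ℕ.< n → f i ≈ g i) → sumUpTo n f ≈ sumUpTo n g
  sumUpTo-cong n e = sum-cong-≋ (λ i → e (toℕ i) (Fin.toℕ<n i))

  sumUpTo-+ : ∀ m n f → sumUpTo (m ℕ.+ n) f ≈ sumUpTo m f + sumUpTo n (λ i → f (m ℕ.+ i))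
  sumUpTo-+ zero    n f = sym (+-identityˡ _)
  sumUpTo-+ (suc m) n f = trans (+-congˡ (sumUpTo-+ m n (f ∘ suc))) (sym (+-assoc _ _ _))

  sumUpTo-truncate : ∀ {m n} f → m ℕ.≤ n → (∀ i → m ℕ.≤ i → f i ≈ 0#) →
                     sumUpTo n f ≈ sumUpTo m f
  sumUpTo-truncate {n = n} f ℕ.z≤n e = sum-zero {n} (λ i → e (toℕ i) ℕ.z≤n)
  sumUpTo-truncate f (ℕ.s≤s m≤n) e =
    +-congˡ (sumUpTo-truncate (f ∘ suc) m≤n (λ i m≤i → e (suc i) (ℕ.s≤s m≤i)))

  sumList : ∀ {b} {B : Set b} → List B → (B → Carrier) → Carrier
  sumList xs f = foldr (λ x y → f x + y) 0# xs

  module _ {b} {B : Set b} where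

    sumList-cong : ∀ (xs : List B) {f g : B → Carrier} → (∀ x → f x ≈ g x) →
                   sumList xs f ≈ sumList xs g
    sumList-cong []       e = refl
    sumList-cong (x ∷ xs) e = +-cong (e x) (sumList-cong xs e)

    *-distribʳ-sumList : ∀ (xs : List B) f y → sumList xs f * y ≈ sumList xs (λ x → f x * y)
    *-distribʳ-sumList []       f y = zeroˡ y
    *-distribʳ-sumList (x ∷ xs) f y = trans (distribʳ y (f x) _) (+-congˡ (*-distribʳ-sumList xs f y))

    sum-sumList : ∀ n (xs : List B) (f : Fin n → B → Carrier) →
                  sum (λ i → sumList xs (f i)) ≈ sumList xs (λ x → sum (λ i → f i x))
    sum-sumList n []       f = sum-replicate-zero n
    sum-sumList n (x ∷ xs) f = trans (∑-distrib-+ (λ i → f i x) _) (+-congˡ (sum-sumList n xs f))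

  module _ {b ℓ₁ ℓ₂} {B : Set b} {_~_ : B → B → Set ℓ₁} {P : B → Set ℓ₂} (P? : ∀ x → Dec (P x)) where

    sumList-⟦⟧-zero : ∀ {xs} → All (¬_ ∘ P) xs → sumList xs (⟦_⟧ ∘ P?) ≈ 0#
    sumList-⟦⟧-zero []               = refl
    sumList-⟦⟧-zero {x ∷ _} (¬p ∷ ¬ps) =
      trans (+-cong (reflexive (⟦⟧-no (P? x) ¬p)) (sumList-⟦⟧-zero ¬ps)) (+-identityˡ 0#)

    -- `P` lies within a single class, and a list of pairwise inequivalent elements meets that class
    -- at most once. This is how a sum over coset representatives counts a vector once.
    sumList-⟦⟧-unique : ∀ {xs} → AllPairs (λ x y → ¬ (x ~ y)) xs → (∀ {x y} → P x → P y → x ~ y) →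
                        Any P xs → sumList xs (⟦_⟧ ∘ P?) ≈ 1#
    sumList-⟦⟧-unique {x ∷ _} (x≁ ∷ _) unique (here px) = trans
      (+-cong (reflexive (⟦⟧-yes (P? x) px)) (sumList-⟦⟧-zero (All.map (λ x≁y py → x≁y (unique px py)) x≁)))
      (+-identityʳ 1#)
    sumList-⟦⟧-unique {x ∷ xs} (x≁ ∷ distinct) unique (there p∈xs) = trans
      (+-cong (reflexive (⟦⟧-no (P? x) λ px → All.lookupAny x≁ p∈xs .proj₁ (unique px (All.lookupAny x≁ p∈xs .proj₂))))
              (sumList-⟦⟧-unique distinct unique p∈xs))
      (+-identityˡ 1#)

  -- Stated through a fixpoint equation, because that is what can be checked coefficientwise both
  -- for the sum of all powers of a series and for the indicator of an arithmetic progression.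
  geometric-inverse : ∀ {x g} → g ≈ 1# + x * g → g * (1# - x) ≈ 1#
  geometric-inverse {x} {g} e = begin
    g * (1# - x)              ≈⟨ x[y-z]≈xy-xz g 1# x ⟩
    g * 1# - g * x            ≈⟨ +-cong (*-identityʳ g) (-‿cong (*-comm g x)) ⟩
    g - x * g                 ≈⟨ +-congʳ (trans e (+-comm _ _)) ⟩
    x * g + 1# - x * g        ≈⟨ xyx⁻¹≈y (x * g) 1# ⟩
    1#                        ∎

  *≈⇒≈* : ∀ {x y z u} → x * y ≈ z → y * u ≈ 1# → x ≈ z * u
  *≈⇒≈* {x} {y} {z} {u} xy≈z yu≈1 = begin
    x            ≈⟨ *-identityʳ x ⟨
    x * 1#       ≈⟨ *-congˡ yu≈1 ⟨
    x * (y * u)  ≈⟨ *-assoc x y u ⟨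
    x * y * u    ≈⟨ *-congʳ xy≈z ⟩
    z * u        ∎

-- Generating functions of decreasing sequences, in which t marks the largest entry and q the sum.  A new largest
-- entry equal to the old one is appended by φ : t ↦ tq, which is a ring homomorphism.
module Substitution {c ℓ} (S : CommutativeRing c ℓ)
  (t q : CommutativeRing.Carrier S) (φ : CommutativeRing.Carrier S → CommutativeRing.Carrier S)
  (φ-isRingHomomorphism :
    RingMorphisms.IsRingHomomorphism (CommutativeRing.rawRing S) (CommutativeRing.rawRing S) φ)
  (φ-t : CommutativeRing._≈_ S (φ t) (CommutativeRing._*_ S t q))
  (φ-q : CommutativeRing._≈_ S (φ q) q)
  where
  open RingLemmas S
  open RingMorphisms.IsRingHomomorphism φ-isRingHomomorphism
    using (+-homo; *-homo; -‿homo; 1#-homo) renaming (⟦⟧-cong to φ-cong)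
  open SetoidReasoning setoid

  φ-^ : ∀ x n → φ (x ^ n) ≈ φ x ^ n
  φ-^ x zero    = 1#-homo
  φ-^ x (suc n) = trans (*-homo x _) (*-congˡ (φ-^ x n))

  φ-product : ∀ {n} (f : Fin n → Carrier) → φ (product f) ≈ product (φ ∘ f)
  φ-product {zero}  f = 1#-homo
  φ-product {suc n} f = trans (*-homo _ _) (*-congˡ (φ-product (f ∘ suc)))

  φ-monomial : ∀ m k → φ (t ^ m * q ^ k) ≈ t ^ m * q ^ (m ℕ.+ k)
  φ-monomial m k = begin
    φ (t ^ m * q ^ k)        ≈⟨ *-homo _ _ ⟩
    φ (t ^ m) * φ (q ^ k)    ≈⟨ *-cong (trans (φ-^ t m) (^-congˡ m φ-t)) (trans (φ-^ q k) (^-congˡ k φ-q)) ⟩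
    (t * q) ^ m * q ^ k      ≈⟨ *-congʳ (^-distrib-* t q m) ⟩
    t ^ m * q ^ m * q ^ k    ≈⟨ *-assoc _ _ _ ⟩
    t ^ m * (q ^ m * q ^ k)  ≈⟨ *-congˡ (^-homo-* q m k) ⟨
    t ^ m * q ^ (m ℕ.+ k)    ∎

  φ-1- : ∀ x → φ (1# - x) ≈ 1# - φ x
  φ-1- x = trans (+-homo 1# (- x)) (+-cong 1#-homo (-‿homo x))

  φ-factor : ∀ m k → φ (1# - t ^ m * q ^ k) ≈ 1# - t ^ m * q ^ (m ℕ.+ k)
  φ-factor m k = trans (φ-1- _) (-‿congˡ (φ-monomial m k))

  -- The theorem's denominator without the factor 1 - t. The factors with `r` belong to the
  -- differences of a decreasing sequence of length `n`, the one with `d` to its last entry.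
  denominator : ℕ → ℕ → ℕ → Carrier
  denominator r d n =
    product {n ∸ 1} (λ j → 1# - t ^ r * q ^ ((toℕ j ℕ.+ 1) ℕ.* r)) * (1# - t ^ d * q ^ (n ℕ.* d))

  -- Each factor gains as many powers of q as it has powers of t, which moves it on to the next
  -- factor; the fresh 1 - t^r becomes the factor with j = 0.
  φ-denominator : ∀ r d n → φ ((1# - t ^ r) * denominator r d (suc n)) ≈ denominator r d (suc (suc n))
  φ-denominator r d n = begin
    φ ((1# - t ^ r) * denominator r d (suc n))
      ≈⟨ trans (*-homo _ _) (*-cong (trans (φ-cong (-‿congˡ (sym (*-identityʳ _)))) (φ-factor r 0))
           (trans (*-homo _ _) (*-cong (φ-product {n} _) (φ-factor d (suc n ℕ.* d))))) ⟩
    (1# - t ^ r * q ^ (r ℕ.+ 0)) *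
      (product {n} (λ j → φ (1# - t ^ r * q ^ ((toℕ j ℕ.+ 1) ℕ.* r))) * (1# - t ^ d * q ^ (d ℕ.+ suc n ℕ.* d)))
      ≈⟨ *-congˡ (*-congʳ (product-cong {n} (λ j → φ-factor r ((toℕ j ℕ.+ 1) ℕ.* r)))) ⟩
    (1# - t ^ r * q ^ (r ℕ.+ 0)) *
      (product {n} (λ j → 1# - t ^ r * q ^ ((suc (toℕ j) ℕ.+ 1) ℕ.* r)) * (1# - t ^ d * q ^ (d ℕ.+ suc n ℕ.* d)))
      ≈⟨ *-assoc _ _ _ ⟨
    denominator r d (suc (suc n)) ∎

  φ-base : ∀ r d {g m} → g * (1# - t ^ d) ≈ t ^ m → φ g * denominator r d 1 ≈ t ^ m * q ^ m
  φ-base r d {g} {m} e = begin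
    φ g * (1# * (1# - t ^ d * q ^ (d ℕ.+ 0)))  ≈⟨ *-congˡ (trans (*-identityˡ _) (sym (φ-factor d 0))) ⟩
    φ g * φ (1# - t ^ d * 1#)                  ≈⟨ *-homo _ _ ⟨
    φ (g * (1# - t ^ d * 1#))                  ≈⟨ φ-cong (trans (*-congˡ (-‿congˡ (*-identityʳ _))) e) ⟩
    φ (t ^ m)                                  ≈⟨ trans (φ-^ t m) (^-congˡ m φ-t) ⟩
    (t * q) ^ m                                ≈⟨ ^-distrib-* t q m ⟩
    t ^ m * q ^ m                              ∎

  -- Here `l` is the largest entry and `k` the sum of the minimal sequence so far. The new entry is
  -- `l + m`, so it is the new exponent of t and is added to the exponent of q.
  φ-step : ∀ r d n {f g l k m} →
           f * denominator r d (suc n) ≈ t ^ l * q ^ k → g * (1# - t ^ r) ≈ t ^ m →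
           φ (f * g) * denominator r d (suc (suc n)) ≈ t ^ (l ℕ.+ m) * q ^ (l ℕ.+ m ℕ.+ k)
  φ-step r d n {f} {g} {l} {k} {m} e e′ = begin
    φ (f * g) * denominator r d (suc (suc n))
      ≈⟨ trans (*-congˡ (sym (φ-denominator r d n))) (sym (*-homo _ _)) ⟩
    φ (f * g * ((1# - t ^ r) * denominator r d (suc n)))
      ≈⟨ φ-cong (solve 4 (λ x y z u → (x :* y) :* (z :* u) := (x :* u) :* (y :* z)) refl f g _ _) ⟩
    φ (f * denominator r d (suc n) * (g * (1# - t ^ r)))
      ≈⟨ φ-cong (trans (*-cong e e′) (solve 3 (λ x y z → (x :* y) :* z := (x :* z) :* y) refl _ _ _)) ⟩
    φ (t ^ l * t ^ m * q ^ k)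
      ≈⟨ φ-cong (*-congʳ (sym (^-homo-* t l m))) ⟩
    φ (t ^ (l ℕ.+ m) * q ^ k)
      ≈⟨ φ-monomial (l ℕ.+ m) k ⟩
    t ^ (l ℕ.+ m) * q ^ (l ℕ.+ m ℕ.+ k) ∎
    where open Solver using (solve; _:*_; _:=_)

-- Sums over boxes of vectors, and the base of the n-th power.

module BoxSums {c ℓ} (S : CommutativeRing c ℓ) where
  open RingLemmas S
  open SetoidReasoning setoid
  open Solver using (solve; _:+_; _:*_; _:=_; con)

  boxSum : ℕ → ∀ n → (Vector ℕ n → Carrier) → Carrier
  boxSum m zero    w = w (λ ())
  boxSum m (suc n) w = sumUpTo m (λ x → boxSum m n (λ f → w (x Vector.∷ f)))

  boxSum-cong : ∀ m n {v w} → (∀ f → v f ≈ w f) → boxSum m n v ≈ boxSum m n w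
  boxSum-cong m zero    e = e _
  boxSum-cong m (suc n) e = sumUpTo-cong m (λ x _ → boxSum-cong m n (λ f → e (x Vector.∷ f)))

  *-distribˡ-boxSum : ∀ m n x w → x * boxSum m n w ≈ boxSum m n (λ f → x * w f)
  *-distribˡ-boxSum m zero    x w = refl
  *-distribˡ-boxSum m (suc n) x w = trans (*-distribˡ-sum {m} x _)
    (sumUpTo-cong m (λ y _ → *-distribˡ-boxSum m n x (λ f → w (y Vector.∷ f))))

  boxSum-sumList : ∀ {b} {B : Set b} m n (xs : List B) (w : Vector ℕ n → B → Carrier) →
                   boxSum m n (λ f → sumList xs (w f)) ≈ sumList xs (λ x → boxSum m n (λ f → w f x))
  boxSum-sumList m zero    xs w = refl
  boxSum-sumList m (suc n) xs w = trans
    (sumUpTo-cong m (λ y _ → boxSum-sumList m n xs (λ f → w (y Vector.∷ f))))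
    (sum-sumList m xs _)

  boxSum-homomorphic : ∀ {h : Carrier → Carrier} → (∀ {x y} → x ≈ y → h x ≈ h y) →
    (∀ {n} (f : Fin n → Carrier) → h (sum f) ≈ sum (h ∘ f)) →
    ∀ m n w → h (boxSum m n w) ≈ boxSum m n (h ∘ w)
  boxSum-homomorphic h-cong h-sum m zero    w = refl
  boxSum-homomorphic h-cong h-sum m (suc n) w = trans (h-sum {m} _)
    (sumUpTo-cong m (λ x _ → boxSum-homomorphic h-cong h-sum m n (λ f → w (x Vector.∷ f))))

  ^-sumUpTo : ∀ m n w → sumUpTo m w ^ n ≈ boxSum m n (λ f → product (w ∘ f))
  ^-sumUpTo m zero    w = refl
  ^-sumUpTo m (suc n) w = begin
    sumUpTo m w * sumUpTo m w ^ n
      ≈⟨ *-distribʳ-sum {m} (sumUpTo m w ^ n) (w ∘ toℕ) ⟩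
    sumUpTo m (λ x → w x * sumUpTo m w ^ n)
      ≈⟨ sumUpTo-cong m (λ x _ → trans (*-congˡ (^-sumUpTo m n w)) (*-distribˡ-boxSum m n (w x) _)) ⟩
    boxSum m (suc n) (λ f → product (w ∘ f)) ∎

  sum-+ : ∀ m n (f : Fin (m ℕ.+ n) → Carrier) → sum f ≈ sum (f ∘ (_↑ˡ n)) + sum (f ∘ (m ↑ʳ_))
  sum-+ zero    n f = sym (+-identityˡ _)
  sum-+ (suc m) n f = trans (+-congˡ (sum-+ m n (f ∘ suc))) (sym (+-assoc _ _ _))

  sum-combine : ∀ m n (f : Fin (m ℕ.* n) → Carrier) → sum f ≈ sum {m} (λ i → sum {n} (λ j → f (combine i j)))
  sum-combine zero    n f = refl
  sum-combine (suc m) n f = trans (sum-+ n (m ℕ.* n) f) (+-congˡ (sum-combine m n (f ∘ (n ↑ʳ_))))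

  -- Vectors are functions, so equality of entries does not give equality of vectors; a summand has
  -- to be known to respect it.
  Extensional : ∀ {n} → (Vector ℕ n → Carrier) → Set ℓ
  Extensional w = ∀ {f g} → f ≗ g → w f ≈ w g

  ∷-extensional : ∀ {n} x {w : Vector ℕ (suc n) → Carrier} → Extensional w →
                  Extensional (λ f → w (x Vector.∷ f))
  ∷-extensional x e {f} {g} f≗g =
    e {x Vector.∷ f} {x Vector.∷ g} λ { zero → ≡.refl ; (suc i) → f≗g i }

  -- Flattens the nested sum into one over `Fin (m ^ n)`, to which invariance of a single sum under
  -- permutations applies.
  boxSum-finToFun : ∀ m n {w} → Extensional w →
                    boxSum m n w ≈ sum {m ℕ.^ n} (λ i → w (toℕ ∘ finToFun {m} {n} i))
  boxSum-finToFun m zero    e = trans (e (λ ())) (sym (+-identityʳ _))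
  boxSum-finToFun m (suc n) {w} e = begin
    sumUpTo m (λ x → boxSum m n (λ f → w (x Vector.∷ f)))
      ≈⟨ sumUpTo-cong m (λ x _ → boxSum-finToFun m n (∷-extensional x e)) ⟩
    sum {m} (λ x → sum {m ℕ.^ n} (λ i → w (toℕ x Vector.∷ (toℕ ∘ finToFun {m} {n} i))))
      ≈⟨ sum-cong-≋ {m} (λ x → sum-cong-≋ {m ℕ.^ n} (λ i → e (λ
           { zero    → ≡.cong (λ z → toℕ (proj₁ z)) (≡.sym (Fin.remQuot-combine {m} x i))
           ; (suc j) → ≡.cong (λ z → toℕ (finToFun {m} {n} (proj₂ z) j)) (≡.sym (Fin.remQuot-combine {m} x i)) }))) ⟩
    sum {m} (λ x → sum {m ℕ.^ n} (λ i → w (toℕ ∘ finToFun {m} {suc n} (combine x i))))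
      ≈⟨ sum-combine m (m ℕ.^ n) _ ⟨
    sum {m ℕ.^ suc n} (λ i → w (toℕ ∘ finToFun {m} {suc n} i)) ∎

  -- Relabelling coordinates by π permutes the codes of vectors: `act` is that action, and the
  -- inverse of π acts as its inverse.
  boxSum-permute : ∀ m n {w} → Extensional w → (π : Permutation′ n) →
                   boxSum m n w ≈ boxSum m n (λ f → w (f ∘ (π ⟨$⟩ʳ_)))
  boxSum-permute m n {w} e π = begin
    boxSum m n w
      ≈⟨ boxSum-finToFun m n e ⟩
    sum (λ i → w (toℕ ∘ finToFun {m} {n} i))
      ≈⟨ sum-permute _ (permutation (act (π ⟨$⟩ʳ_)) (act (π ⟨$⟩ˡ_))
           (act-act (π ⟨$⟩ˡ_) (π ⟨$⟩ʳ_) (λ j → Perm.inverseˡ π))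
           (act-act (π ⟨$⟩ʳ_) (π ⟨$⟩ˡ_) (λ j → Perm.inverseʳ π))) ⟩
    sum (λ i → w (toℕ ∘ finToFun {m} {n} (act (π ⟨$⟩ʳ_) i)))
      ≈⟨ sum-cong-≋ {m ℕ.^ n} (λ i → e (λ j → ≡.cong toℕ (Fin.finToFun-funToFin (finToFun i ∘ (π ⟨$⟩ʳ_)) j))) ⟩
    sum (λ i → w (toℕ ∘ finToFun {m} {n} i ∘ (π ⟨$⟩ʳ_)))
      ≈⟨ boxSum-finToFun m n (λ f≗g → e (f≗g ∘ (π ⟨$⟩ʳ_))) ⟨
    boxSum m n (λ f → w (f ∘ (π ⟨$⟩ʳ_))) ∎
    where
    act : (Fin n → Fin n) → Fin (m ℕ.^ n) → Fin (m ℕ.^ n)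
    act h i = funToFin (finToFun {m} {n} i ∘ h)
    funToFin-cong : ∀ {k} {f g : Fin k → Fin m} → f ≗ g → funToFin f ≡ funToFin g
    funToFin-cong {zero}  e = ≡.refl
    funToFin-cong {suc k} e = ≡.cong₂ combine (e zero) (funToFin-cong (e ∘ suc))
    act-act : ∀ g h → (∀ j → g (h j) ≡ j) → ∀ i → act h (act g i) ≡ i
    act-act g h e i = ≡.trans
      (funToFin-cong (λ j → ≡.trans (Fin.finToFun-funToFin (finToFun i ∘ g) (h j)) (≡.cong (finToFun i) (e j))))
      (Fin.funToFin-finToFin {n} {m} i)

  module _ (q a : Carrier) (d : ℕ) .{{_ : NonZero d}} where

    weight : ℕ → Carrier
    weight x = q ^ x * a ^ (x % d)

    [_]⟨_⟩ : ℕ → Carrier → Carrier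
    [ m ]⟨ x ⟩ = sumUpTo m (x ^_)

    -- On this block the quotient by `d` stays `k` and the residue is `i`, so the weights form a
    -- geometric progression with ratio `a * q`; its first term is split off.
    sum-weight-block : ∀ k m → m ℕ.< d →
      sumUpTo (suc m) (λ i → weight (k ℕ.* d ℕ.+ i)) ≈ q ^ (k ℕ.* d) * (1# + a * q * [ m ]⟨ a * q ⟩)
    sum-weight-block k m m<d = begin
      sumUpTo (suc m) (λ i → weight (k ℕ.* d ℕ.+ i))
        ≈⟨ sumUpTo-cong (suc m) (λ i i≤m → trans
             (*-cong (^-homo-* q (k ℕ.* d) i) (^-congʳ a (residue i i≤m)))
             (trans (*-assoc _ _ _) (*-congˡ (trans (*-comm _ _) (sym (^-distrib-* a q i)))))) ⟩
      sumUpTo (suc m) (λ i → q ^ (k ℕ.* d) * (a * q) ^ i)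
        ≈⟨ *-distribˡ-sum {suc m} (q ^ (k ℕ.* d)) (λ i → (a * q) ^ toℕ i) ⟨
      q ^ (k ℕ.* d) * (1# + sumUpTo m (λ i → a * q * (a * q) ^ i))
        ≈⟨ *-congˡ (+-congˡ (*-distribˡ-sum {m} (a * q) _)) ⟨
      q ^ (k ℕ.* d) * (1# + a * q * [ m ]⟨ a * q ⟩) ∎
      where
      residue : ∀ i → i ℕ.< suc m → (k ℕ.* d ℕ.+ i) % d ≡ i
      residue i (ℕ.s≤s i≤m) = ≡.trans (≡.cong (_% d) (ℕ.+-comm (k ℕ.* d) i))
        (≡.trans ([m+kn]%n≡m%n i k d) (m<n⇒m%n≡m (ℕ.≤-<-trans i≤m m<d)))

    sum-weight-multiple : ∀ k →
      sumUpTo (k ℕ.* d) weight ≈ (1# + a * q * [ d ∸ 1 ]⟨ a * q ⟩) * [ k ]⟨ q ^ d ⟩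
    sum-weight-multiple zero    = sym (zeroʳ _)
    sum-weight-multiple (suc k) = begin
      sumUpTo (d ℕ.+ k ℕ.* d) weight
        ≡⟨ ≡.cong (λ j → sumUpTo j weight) (ℕ.+-comm d (k ℕ.* d)) ⟩
      sumUpTo (k ℕ.* d ℕ.+ d) weight
        ≈⟨ sumUpTo-+ (k ℕ.* d) d weight ⟩
      sumUpTo (k ℕ.* d) weight + sumUpTo d (λ i → weight (k ℕ.* d ℕ.+ i))
        ≡⟨ ≡.cong (λ j → sumUpTo (k ℕ.* d) weight + sumUpTo j (λ i → weight (k ℕ.* d ℕ.+ i))) (ℕ.suc-pred d) ⟨
      sumUpTo (k ℕ.* d) weight + sumUpTo (suc (ℕ.pred d)) (λ i → weight (k ℕ.* d ℕ.+ i))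
        ≈⟨ +-cong (sum-weight-multiple k) (sum-weight-block k (ℕ.pred d) (ℕ.≤-reflexive (ℕ.suc-pred d))) ⟩
      u * [ k ]⟨ q ^ d ⟩ + q ^ (k ℕ.* d) * u
        ≈⟨ +-congˡ (trans (*-comm _ _) (*-congˡ (sym (q^d^ k)))) ⟩
      u * [ k ]⟨ q ^ d ⟩ + u * (q ^ d) ^ k
        ≈⟨ distribˡ u _ _ ⟨
      u * ([ k ]⟨ q ^ d ⟩ + (q ^ d) ^ k)
        ≈⟨ *-congˡ (sumUpTo-suc k ((q ^ d) ^_)) ⟨
      u * [ suc k ]⟨ q ^ d ⟩ ∎
      where
      u = 1# + a * q * [ d ∸ 1 ]⟨ a * q ⟩
      q^d^ : ∀ k → (q ^ d) ^ k ≈ q ^ (k ℕ.* d)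
      q^d^ k = trans (^-assocʳ q d k) (^-congʳ q (ℕ.*-comm d k))

    -- The values 0,...,k form `k / d` full blocks and a last one with `k % d + 1` members. The
    -- first member of the last block raises the bracket of `Q` to that of `Q + 1`.
    sum-weight : ∀ k →
      [ k / d ℕ.+ 1 ]⟨ q ^ d ⟩ + a * q * [ d ∸ 1 ]⟨ a * q ⟩ * [ k / d ]⟨ q ^ d ⟩
        + a * q ^ (k / d ℕ.* d ℕ.+ 1) * [ k % d ]⟨ a * q ⟩
      ≈ sumUpTo (suc k) weight
    sum-weight k = sym (begin
      sumUpTo (suc k) weight
        ≡⟨ ≡.cong (λ j → sumUpTo j weight) (≡.trans (≡.cong suc (m≡m%n+[m/n]*n k d)) (ℕ.+-comm (suc (k % d)) (Q ℕ.* d))) ⟩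
      sumUpTo (Q ℕ.* d ℕ.+ suc (k % d)) weight
        ≈⟨ trans (sumUpTo-+ (Q ℕ.* d) (suc (k % d)) weight)
             (+-cong (sum-weight-multiple Q) (sum-weight-block Q (k % d) (m%n<n k d))) ⟩
      (1# + x * y) * z + q ^ (Q ℕ.* d) * (1# + a * q * v)
        ≈⟨ solve 7 (λ x y z u v a q → (con 1 :+ x :* y) :* z :+ u :* (con 1 :+ a :* q :* v)
              := z :+ u :+ x :* y :* z :+ a :* (u :* (q :* con 1)) :* v) refl x y z (q ^ (Q ℕ.* d)) v a q ⟩
      z + q ^ (Q ℕ.* d) + x * y * z + a * (q ^ (Q ℕ.* d) * (q * 1#)) * v
        ≈⟨ +-cong (+-congʳ (sym Q+1)) (*-congʳ (*-congˡ (sym (^-homo-* q (Q ℕ.* d) 1)))) ⟩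
      [ Q ℕ.+ 1 ]⟨ q ^ d ⟩ + x * y * z + a * q ^ (Q ℕ.* d ℕ.+ 1) * v ∎)
      where
      Q = k / d
      x = a * q
      y = [ d ∸ 1 ]⟨ a * q ⟩
      z = [ Q ]⟨ q ^ d ⟩
      v = [ k % d ]⟨ a * q ⟩
      Q+1 : [ Q ℕ.+ 1 ]⟨ q ^ d ⟩ ≈ z + q ^ (Q ℕ.* d)
      Q+1 = trans (reflexive (≡.cong [_]⟨ q ^ d ⟩ (ℕ.+-comm Q 1)))
        (trans (sumUpTo-suc Q ((q ^ d) ^_)) (+-congˡ (trans (^-assocʳ q d Q) (^-congʳ q (ℕ.*-comm d Q)))))

-- Congruences and arithmetic progressions in ℕ.

module Congruences where
  open import Data.Nat.Base using (_+_; _*_; _<_)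
  open import Relation.Binary.PropositionalEquality using (refl; sym; trans; cong; cong₂; subst)

  infix 4 _≡_[mod_]
  -- Multiples are allowed on both sides so that no truncated subtraction occurs.
  record _≡_[mod_] (a b m : ℕ) : Set where
    constructor mod-by
    field
      u v      : ℕ
      equation : a + u * m ≡ b + v * m

  module _ {m : ℕ} where

    mod-refl : ∀ {a} → a ≡ a [mod m ]
    mod-refl = mod-by 0 0 refl

    mod-reflexive : ∀ {a b} → a ≡ b → a ≡ b [mod m ]
    mod-reflexive refl = mod-refl

    mod-sym : ∀ {a b} → a ≡ b [mod m ] → b ≡ a [mod m ]
    mod-sym (mod-by u v e) = mod-by v u (sym e)

    mod-+ : ∀ {a b c d} → a ≡ b [mod m ] → c ≡ d [mod m ] → a + c ≡ b + d [mod m ]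
    mod-+ {a} {b} {c} {d} (mod-by u v e) (mod-by u′ v′ e′) = mod-by (u + u′) (v + v′) (begin
      a + c + (u + u′) * m        ≡⟨ rearrange a c u u′ m ⟩
      (a + u * m) + (c + u′ * m)  ≡⟨ cong₂ _+_ e e′ ⟩
      (b + v * m) + (d + v′ * m)  ≡⟨ rearrange b d v v′ m ⟨
      b + d + (v + v′) * m        ∎)
      where
      open ≡.≡-Reasoning
      rearrange : ∀ a c u v m → a + c + (u + v) * m ≡ (a + u * m) + (c + v * m)
      rearrange = solve-∀

    mod-cancelʳ : ∀ {a b} c → a + c ≡ b + c [mod m ] → a ≡ b [mod m ]
    mod-cancelʳ {a} {b} c (mod-by u v e) = mod-by u v (ℕ.+-cancelʳ-≡ c _ _ (begin
      a + u * m + c  ≡⟨ rearrange a (u * m) c ⟩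
      a + c + u * m  ≡⟨ e ⟩
      b + c + v * m  ≡⟨ rearrange b (v * m) c ⟨
      b + v * m + c  ∎))
      where
      open ≡.≡-Reasoning
      rearrange : ∀ x y z → x + y + z ≡ x + z + y
      rearrange = solve-∀

    -- The sum of the two congruences has the middle term `b` on both sides, where it cancels.
    mod-trans : ∀ {a b c} → a ≡ b [mod m ] → b ≡ c [mod m ] → a ≡ c [mod m ]
    mod-trans {a} {b} {c} e f = mod-cancelʳ b
      (subst (λ x → a + b ≡ x [mod m ]) (ℕ.+-comm b c) (mod-+ e f))

    mod-∣ : ∀ {a b} → a ≡ b [mod m ] → m ∣ a → m ∣ b
    mod-∣ {a} {b} (mod-by u v e) m∣a = ∣.∣m+n∣m⇒∣n
      (subst (m ∣_) (trans e (ℕ.+-comm b (v * m))) (∣.∣m∣n⇒∣m+n m∣a (∣.n∣m*n u))) (∣.n∣m*n v)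

    mod-weaken : ∀ {k a b} → k ∣ m → a ≡ b [mod m ] → a ≡ b [mod k ]
    mod-weaken {k} {a} {b} (divides x refl) (mod-by u v e) = mod-by (u * x) (v * x)
      (trans (cong (a +_) (ℕ.*-assoc u x k)) (trans e (cong (b +_) (sym (ℕ.*-assoc v x k)))))

    mod-multiple : ∀ a k → a + k * m ≡ a [mod m ]
    mod-multiple a k = mod-by 0 k (ℕ.+-identityʳ _)

    module _ .{{_ : NonZero m}} where

      mod⇒% : ∀ {a b} → a ≡ b [mod m ] → a % m ≡ b % m
      mod⇒% {a} {b} (mod-by u v e) = trans (sym ([m+kn]%n≡m%n a u m)) (trans (cong (_% m) e) ([m+kn]%n≡m%n b v m))

      mod-% : ∀ a → a % m ≡ a [mod m ]
      mod-% a = mod-by (a / m) 0 (trans (sym (m≡m%n+[m/n]*n a m)) (sym (ℕ.+-identityʳ a)))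

      mod-<⇒≡ : ∀ {a b} → a < m → b < m → a ≡ b [mod m ] → a ≡ b
      mod-<⇒≡ a<m b<m e = trans (sym (m<n⇒m%n≡m a<m)) (trans (mod⇒% e) (m<n⇒m%n≡m b<m))

    -- Translates the integer remainder in the definition of k_i into a congruence in ℕ. The sign of
    -- the integer quotient decides on which side the multiple of `m` is placed.
    mod-difference : ∀ .{{_ : NonZero m}} x y → (pos x ℤ.- pos y) %ℕ m + y ≡ x [mod m ]
    mod-difference x y = quotient ((pos x ℤ.- pos y) /ℕ m) (begin
      pos x                                          ≡⟨ shift (pos x) (pos y) ⟩
      (pos x ℤ.- pos y) ℤ.+ pos y                        ≡⟨ cong (ℤ._+ pos y) (a≡a%ℕn+[a/ℕn]*n (pos x ℤ.- pos y) m) ⟩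
      (pos ε ℤ.+ ((pos x ℤ.- pos y) /ℕ m) ℤ.* pos m) ℤ.+ pos y ∎)
      where
      open ≡.≡-Reasoning
      ε = (pos x ℤ.- pos y) %ℕ m
      shift : ∀ i j → i ≡ (i ℤ.- j) ℤ.+ j
      shift = ℤ-Solver.solve-∀
      rearrange⁺ : ∀ i j k → (i ℤ.+ j) ℤ.+ k ≡ (i ℤ.+ k) ℤ.+ j
      rearrange⁺ = ℤ-Solver.solve-∀
      rearrange⁻ : ∀ i j k l → ((i ℤ.+ (ℤ.- j) ℤ.* k) ℤ.+ l) ℤ.+ j ℤ.* k ≡ i ℤ.+ l
      rearrange⁻ = ℤ-Solver.solve-∀
      quotient : ∀ k → pos x ≡ (pos ε ℤ.+ k ℤ.* pos m) ℤ.+ pos y → ε + y ≡ x [mod m ]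
      quotient (pos k) e = mod-by k 0 (ℤ.+-injective (begin
        pos (ε + y) ℤ.+ pos (k * m)                ≡⟨ cong₂ ℤ._+_ (ℤ.pos-+ ε y) (ℤ.pos-* k m) ⟩
        pos ε ℤ.+ pos y ℤ.+ pos k ℤ.* pos m            ≡⟨ rearrange⁺ (pos ε) (pos k ℤ.* pos m) (pos y) ⟨
        (pos ε ℤ.+ pos k ℤ.* pos m) ℤ.+ pos y          ≡⟨ e ⟨
        pos x                                    ≡⟨ cong pos (ℕ.+-identityʳ x) ⟨
        pos (x + 0)                              ∎))
      quotient (negsuc k) e = mod-by 0 (suc k) (ℤ.+-injective (begin
        pos (ε + y + 0)                                           ≡⟨ cong pos (ℕ.+-identityʳ (ε + y)) ⟩
        pos ε ℤ.+ pos y                                             ≡⟨ rearrange⁻ (pos ε) (pos (suc k)) (pos m) (pos y) ⟨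
        ((pos ε ℤ.+ (negsuc k) ℤ.* pos m) ℤ.+ pos y) ℤ.+ pos (suc k) ℤ.* pos m  ≡⟨ cong₂ ℤ._+_ (sym e) (sym (ℤ.pos-* (suc k) m)) ⟩
        pos (x + suc k * m)                                       ∎))

  sumℕ-mod : ∀ {m n} (f g : Vector ℕ n) → (∀ i → f i ≡ g i [mod m ]) → sumℕ f ≡ sumℕ g [mod m ]
  sumℕ-mod {n = zero}  f g e = mod-refl
  sumℕ-mod {n = suc n} f g e = mod-+ (e zero) (sumℕ-mod (tail f) (tail g) (e ∘ suc))

  sumℕ-+-const : ∀ {n} (f : Vector ℕ n) y → sumℕ (λ i → f i + y) ≡ sumℕ f + n * y
  sumℕ-+-const {zero}  f y = refl
  sumℕ-+-const {suc n} f y =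
    trans (cong (f zero + y +_) (sumℕ-+-const (tail f) y)) (rearrange (f zero) y (sumℕ (tail f)) n)
    where
    rearrange : ∀ a y z n → a + y + (z + n * y) ≡ a + z + suc n * y
    rearrange = solve-∀

  toℕ-mod : ∀ a m .{{_ : NonZero m}} → toℕ (a mod m) ≡ a [mod m ]
  toℕ-mod a m = subst (λ x → x ≡ a [mod m ]) (sym (Fin.toℕ-fromℕ< (m%n<n a m))) (mod-% a)

module Progressions where
  open import Data.Nat.Base using (_+_; _*_; _≤_)
  open import Relation.Binary.PropositionalEquality using (refl; sym; trans; cong; subst)

  -- The exponents occurring in t^b / (1 - t^m). The inequality guards against truncation in
  -- `j ∸ b`.
  Progression : ℕ → ℕ → ℕ → Set
  Progression b m j = b ≤ j × m ∣ j ∸ b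

  Progression? : ∀ b m j → Dec (Progression b m j)
  Progression? b m j = (b ℕ.≤? j) ×-dec (m ∣? (j ∸ b))

  progression⇒ : ∀ {b m j} → Progression b m j → ∃ λ k → j ≡ b + k * m
  progression⇒ {b} {m} {j} (b≤j , divides k e) = k , trans (sym (ℕ.m+[n∸m]≡n b≤j)) (cong (b ℕ.+_) e)

  ⇒progression : ∀ b m k → Progression b m (b + k * m)
  ⇒progression b m k = ℕ.m≤m+n b _ , divides k (ℕ.m+n∸m≡n b (k * m))

  %-progression : ∀ {j} m .{{_ : NonZero m}} b → j % m ≡ b → Progression b m j
  %-progression {j} m _ refl = subst (Progression (j % m) m) (sym (m≡m%n+[m/n]*n j m)) (⇒progression (j % m) m (j / m))

  data Split (m : ℕ) : ℕ → Set where
    below : ∀ {k} → k ℕ.< m → Split m k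
    above : ∀ k → Split m (m ℕ.+ k)

  split : ∀ m k → Split m k
  split m k with m ℕ.≤? k
  ... | yes m≤k = ≡.subst (Split m) (ℕ.m+[n∸m]≡n m≤k) (above (k ∸ m))
  ... | no  m≰k = below (ℕ.≰⇒> m≰k)

open Progressions

-- The ring of formal power series over a commutative ring.

module PowerSeriesRing {c ℓ} (K : CommutativeRing c ℓ) where
  open RingLemmas K
  open Solver using (solve; _:+_; _:*_; _:=_)
  open SetoidReasoning setoid

  PowerSeries = Defs.PowerSeries rawRing
  const = Defs.constant rawRing
  t = Defs.indeterminate rawRing

  open RawRing PowerSeries using ()
    renaming (_≈_ to _≋_; _+_ to _⊞_; _*_ to _⊛_; 1# to 𝟙; 0# to 𝟘)

  infixr 8 _·_
  _·_ : Carrier → (ℕ → Carrier) → (ℕ → Carrier)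
  (x · F) k = x * F k

  ⊛-cong : ∀ {F F′ G G′} → F ≋ F′ → G ≋ G′ → F ⊛ G ≋ F′ ⊛ G′
  ⊛-cong e f k = sum-cong-≋ {suc k} (λ i → *-cong (e (toℕ i)) (f (k ∸ toℕ i)))

  -- The definition of the product splits off the head of `F`; splitting off the head of `G` instead
  -- supplies the mirror image that commutativity needs.
  ⊛-suc′ : ∀ F G k → (F ⊛ G) (suc k) ≈ (F ⊛ (G ∘ suc)) k + F (suc k) * G 0
  ⊛-suc′ F G zero = begin
    F 0 * G 1 + (F 1 * G 0 + 0#)  ≈⟨ +-congˡ (+-identityʳ _) ⟩
    F 0 * G 1 + F 1 * G 0         ≈⟨ +-congʳ (+-identityʳ _) ⟨
    F 0 * G 1 + 0# + F 1 * G 0    ∎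
  ⊛-suc′ F G (suc k) = trans (+-congˡ (⊛-suc′ (F ∘ suc) G k)) (sym (+-assoc _ _ _))

  ⊛-comm : ∀ F G → F ⊛ G ≋ G ⊛ F
  ⊛-comm F G zero = +-congʳ (*-comm _ _)
  ⊛-comm F G (suc k) = begin
    F 0 * G (suc k) + ((F ∘ suc) ⊛ G) k  ≈⟨ +-cong (*-comm _ _) (⊛-comm (F ∘ suc) G k) ⟩
    G (suc k) * F 0 + (G ⊛ (F ∘ suc)) k  ≈⟨ +-comm _ _ ⟩
    (G ⊛ (F ∘ suc)) k + G (suc k) * F 0  ≈⟨ ⊛-suc′ G F k ⟨
    (G ⊛ F) (suc k)                      ∎

  ⊛-distribʳ : ∀ F G H → (F ⊞ G) ⊛ H ≋ (F ⊛ H) ⊞ (G ⊛ H)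
  ⊛-distribʳ F G H zero = begin
    (F 0 + G 0) * H 0 + 0#                 ≈⟨ +-identityʳ _ ⟩
    (F 0 + G 0) * H 0                      ≈⟨ distribʳ _ _ _ ⟩
    F 0 * H 0 + G 0 * H 0                  ≈⟨ +-cong (+-identityʳ _) (+-identityʳ _) ⟨
    (F 0 * H 0 + 0#) + (G 0 * H 0 + 0#)    ∎
  ⊛-distribʳ F G H (suc k) = begin
    (F 0 + G 0) * H (suc k) + (((F ∘ suc) ⊞ (G ∘ suc)) ⊛ H) k
      ≈⟨ +-congˡ (⊛-distribʳ (F ∘ suc) (G ∘ suc) H k) ⟩
    _ ≈⟨ solve 5 (λ a b c d e → ((a :+ b) :* c :+ (d :+ e)) := ((a :* c :+ d) :+ (b :* c :+ e))) refl _ _ _ _ _ ⟩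
    (F 0 * H (suc k) + ((F ∘ suc) ⊛ H) k) + (G 0 * H (suc k) + ((G ∘ suc) ⊛ H) k) ∎

  ·-⊛ : ∀ x F G → (x · F) ⊛ G ≋ x · (F ⊛ G)
  ·-⊛ x F G k = trans (sum-cong-≋ {suc k} (λ i → *-assoc x (F (toℕ i)) (G (k ∸ toℕ i))))
    (sym (*-distribˡ-sum {suc k} x (λ i → F (toℕ i) * G (k ∸ toℕ i))))

  ⊛-assoc : ∀ F G H → (F ⊛ G) ⊛ H ≋ F ⊛ (G ⊛ H)
  ⊛-assoc F G H zero = +-congʳ (begin
    (F 0 * G 0 + 0#) * H 0  ≈⟨ *-congʳ (+-identityʳ _) ⟩
    F 0 * G 0 * H 0         ≈⟨ *-assoc _ _ _ ⟩
    F 0 * (G 0 * H 0)       ≈⟨ *-congˡ (+-identityʳ _) ⟨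
    F 0 * (G 0 * H 0 + 0#)  ∎)
  ⊛-assoc F G H (suc k) = begin
    (F ⊛ G) 0 * H (suc k) + ((F 0 · (G ∘ suc) ⊞ ((F ∘ suc) ⊛ G)) ⊛ H) k
      ≈⟨ +-congˡ (⊛-distribʳ (F 0 · (G ∘ suc)) ((F ∘ suc) ⊛ G) H k) ⟩
    (F ⊛ G) 0 * H (suc k) + (((F 0 · (G ∘ suc)) ⊛ H) k + (((F ∘ suc) ⊛ G) ⊛ H) k)
      ≈⟨ +-cong (*-congʳ (+-identityʳ _)) (+-cong (·-⊛ (F 0) (G ∘ suc) H k) (⊛-assoc (F ∘ suc) G H k)) ⟩
    F 0 * G 0 * H (suc k) + (F 0 * ((G ∘ suc) ⊛ H) k + ((F ∘ suc) ⊛ (G ⊛ H)) k)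
      ≈⟨ solve 5 (λ a b c d e → (a :* b :* c :+ (a :* d :+ e)) := (a :* (b :* c :+ d) :+ e)) refl _ _ _ _ _ ⟩
    F 0 * (G 0 * H (suc k) + ((G ∘ suc) ⊛ H) k) + ((F ∘ suc) ⊛ (G ⊛ H)) k ∎

  constant-⊛ : ∀ x F → const x ⊛ F ≋ x · F
  constant-⊛ x F zero = +-identityʳ _
  constant-⊛ x F (suc k) = trans (+-congˡ (𝟘-⊛ k)) (+-identityʳ _)
    where
    𝟘-⊛ : ∀ k → (𝟘 ⊛ F) k ≈ 0#
    𝟘-⊛ k = sum-zero {suc k} (λ i → zeroˡ (F (k ∸ toℕ i)))

  powerSeries-isCommutativeRing : IsCommutativeRing _≋_ _⊞_ _⊛_ (RawRing.-_ PowerSeries) 𝟘 𝟙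
  powerSeries-isCommutativeRing = record
    { isRing = record
      { +-isAbelianGroup = record
        { isGroup = record
          { isMonoid = record
            { isSemigroup = record
              { isMagma = record
                { isEquivalence = record
                  { refl = λ _ → refl ; sym = λ e k → sym (e k) ; trans = λ e f k → trans (e k) (f k) }
                ; ∙-cong = λ e f k → +-cong (e k) (f k) }
              ; assoc = λ F G H k → +-assoc _ _ _ }
            ; identity = (λ F k → +-identityˡ _) , (λ F k → +-identityʳ _) }
          ; inverse = (λ F k → -‿inverseˡ _) , (λ F k → -‿inverseʳ _)
          ; ⁻¹-cong = λ e k → -‿cong (e k) }
        ; comm = λ F G k → +-comm _ _ }
      ; *-cong = ⊛-cong
      ; *-assoc = ⊛-assoc
      ; *-identity = 𝟙-⊛ , λ F k → trans (⊛-comm F 𝟙 k) (𝟙-⊛ F k)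
      ; distrib = (λ F G H k → trans (⊛-comm F (G ⊞ H) k)
                     (trans (⊛-distribʳ G H F k) (+-cong (⊛-comm G F k) (⊛-comm H F k))))
                , (λ F G H → ⊛-distribʳ G H F) }
    ; *-comm = ⊛-comm }
    where
    𝟙-⊛ : ∀ F → 𝟙 ⊛ F ≋ F
    𝟙-⊛ F k = trans (constant-⊛ 1# F k) (*-identityˡ (F k))

  powerSeriesRing : CommutativeRing c ℓ
  powerSeriesRing = record { isCommutativeRing = powerSeries-isCommutativeRing }

  module S = RingLemmas powerSeriesRing

  ⊛-head : ∀ F G → (F ⊛ G) 0 ≈ F 0 * G 0
  ⊛-head F G = +-identityʳ _

  coeff-sum : ∀ {n} (F : Fin n → ℕ → Carrier) k → S.sum F k ≡ sum (λ i → F i k)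
  coeff-sum {zero}  F k = ≡.refl
  coeff-sum {suc n} F k = ≡.cong (F zero k +_) (coeff-sum (F ∘ suc) k)

  coeff-sumList : ∀ {b} {B : Set b} (xs : List B) (F : B → ℕ → Carrier) k →
                  S.sumList xs F k ≡ sumList xs (λ x → F x k)
  coeff-sumList []       F k = ≡.refl
  coeff-sumList (x ∷ xs) F k = ≡.cong (F x k +_) (coeff-sumList xs F k)

  const-* : ∀ x y → const (x * y) ≋ const x ⊛ const y
  const-* x y k = sym (trans (constant-⊛ x (const y) k) (lemma k))
    where
    lemma : ∀ k → x * const y k ≈ const (x * y) k
    lemma zero    = refl
    lemma (suc k) = zeroʳ x

  const-^ : ∀ x n → const (x ^ n) ≋ const x S.^ n
  const-^ x zero    k = refl
  const-^ x (suc n) = S.trans {const (x ^ suc n)} {const x ⊛ const (x ^ n)} {const x S.^ suc n}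
    (const-* x (x ^ n)) (⊛-cong {const x} (λ _ → refl) (const-^ x n))

  const-sum : ∀ {n} (f : Fin n → Carrier) → const (sum f) ≋ S.sum (const ∘ f)
  const-sum {zero}  f zero    = refl
  const-sum {zero}  f (suc k) = refl
  const-sum {suc n} f k = trans (lemma k) (+-congˡ (const-sum (f ∘ suc) k))
    where
    lemma : ∀ k → const (f zero + sum (f ∘ suc)) k ≈ const (f zero) k + const (sum (f ∘ suc)) k
    lemma zero    = refl
    lemma (suc k) = sym (+-identityˡ 0#)

  1-0≈1 : 1# - 0# ≈ 1#
  1-0≈1 = trans (sym (+-identityʳ _)) (trans (+-assoc _ _ _) (trans (+-congˡ (-‿inverseˡ 0#)) (+-identityʳ 1#)))

  t-⊛-zero : ∀ F → (t ⊛ F) 0 ≈ 0#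
  t-⊛-zero F = trans (⊛-head t F) (zeroˡ _)

  t-⊛-suc : ∀ F k → (t ⊛ F) (suc k) ≈ F k
  t-⊛-suc F k = begin
    0# * F (suc k) + ((t ∘ suc) ⊛ F) k  ≈⟨ trans (+-congʳ (zeroˡ _)) (+-identityˡ _) ⟩
    ((t ∘ suc) ⊛ F) k                   ≈⟨ ⊛-cong {t ∘ suc} {𝟙} {F} {F} t∘suc (λ _ → refl) k ⟩
    (𝟙 ⊛ F) k                           ≈⟨ S.*-identityˡ F k ⟩
    F k                                 ∎
    where
    t∘suc : ∀ k → t (suc k) ≈ 𝟙 k
    t∘suc zero    = refl
    t∘suc (suc k) = refl

  t^-⊛-< : ∀ {k} m F → k ℕ.< m → ((t S.^ m) ⊛ F) k ≈ 0#
  t^-⊛-< {zero}  (suc m) F _ = trans (S.*-assoc t (t S.^ m) F 0) (t-⊛-zero ((t S.^ m) ⊛ F))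
  t^-⊛-< {suc k} (suc m) F (ℕ.s≤s k<m) =
    trans (S.*-assoc t (t S.^ m) F (suc k)) (trans (t-⊛-suc ((t S.^ m) ⊛ F) k) (t^-⊛-< m F k<m))

  t^-⊛-+ : ∀ m F k → ((t S.^ m) ⊛ F) (m ℕ.+ k) ≈ F k
  t^-⊛-+ zero    F k = S.*-identityˡ F k
  t^-⊛-+ (suc m) F k = trans (S.*-assoc t (t S.^ m) F (suc (m ℕ.+ k)))
    (trans (t-⊛-suc ((t S.^ m) ⊛ F) (m ℕ.+ k)) (t^-⊛-+ m F k))

  -- A constant times t^k lives in degree k only, so in degree m every term but k = m vanishes. This
  -- reads off the coefficient of t^m on the left of the theorem.
  ∑∞-t^-const : ∀ {F : ℕ → ℕ → Carrier} {f : ℕ → Carrier} → (∀ k → F k ≋ const (f k)) →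
                Defs.infiniteSum rawRing (λ k → (t S.^ k) ⊛ F k) ≋ f
  ∑∞-t^-const {F} {f} e m = begin
    sumUpTo (suc m) (λ k → ((t S.^ k) ⊛ F k) m)
      ≈⟨ sumUpTo-suc m (λ k → ((t S.^ k) ⊛ F k) m) ⟩
    sumUpTo m (λ k → ((t S.^ k) ⊛ F k) m) + ((t S.^ m) ⊛ F m) m
      ≈⟨ +-cong (trans (sumUpTo-cong m lower) (sum-replicate-zero m))
                (≡.subst (λ j → ((t S.^ m) ⊛ F m) j ≈ F m 0) (ℕ.+-identityʳ m) (t^-⊛-+ m (F m) 0)) ⟩
    0# + F m 0 ≈⟨ trans (+-identityˡ _) (e m 0) ⟩
    f m ∎
    where
    lower : ∀ k → k ℕ.< m → ((t S.^ k) ⊛ F k) m ≈ 0#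
    lower k k<m with i , ≡.refl ← ℕ.m≤n⇒∃[o]m+o≡n k<m =
      ≡.subst (λ j → ((t S.^ k) ⊛ F k) j ≈ 0#) (ℕ.+-suc k i) (trans (t^-⊛-+ k (F k) (suc i)) (e k (suc i)))

  -- The operation written with q^p in the theorem, the variable of this ring playing q. As a
  -- multiplication by an indicator it is additive by distributivity.
  keepMultiples : ℕ → (ℕ → Carrier) → (ℕ → Carrier)
  keepMultiples p F k = ⟦ p ∣? k ⟧ * F k

  keepMultiples-sum : ∀ p {n} (F : Fin n → ℕ → Carrier) → keepMultiples p (S.sum F) ≋ S.sum (keepMultiples p ∘ F)
  keepMultiples-sum p {zero}  F k = zeroʳ _
  keepMultiples-sum p {suc n} F k = trans (distribˡ _ (F zero k) (S.sum (F ∘ suc) k)) (+-congˡ (keepMultiples-sum p (F ∘ suc) k))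

  -- In degrees other than `m` both sides are zero; in degree `m` the two indicators agree.
  keepMultiples-monomial : ∀ p m x → keepMultiples p ((t S.^ m) ⊛ const x) ≋ S.⟦ p ∣? m ⟧ ⊛ ((t S.^ m) ⊛ const x)
  keepMultiples-monomial p m x k = sym (trans (scale (p ∣? m)) (agree (split m k)))
    where
    F = (t S.^ m) ⊛ const x
    scale : (D : Dec (p ∣ m)) → (S.⟦ D ⟧ ⊛ F) k ≈ ⟦ D ⟧ * F k
    scale (yes _) = trans (S.*-identityˡ F k) (sym (*-identityˡ (F k)))
    scale (no _)  = trans (S.zeroˡ F k) (sym (zeroˡ (F k)))
    vanish : ∀ {k} → F k ≈ 0# → ⟦ p ∣? m ⟧ * F k ≈ ⟦ p ∣? k ⟧ * F k
    vanish e = trans (trans (*-congˡ e) (zeroʳ _)) (sym (trans (*-congˡ e) (zeroʳ _)))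
    agree : ∀ {k} → Split m k → ⟦ p ∣? m ⟧ * F k ≈ ⟦ p ∣? k ⟧ * F k
    agree (below k<m)   = vanish (t^-⊛-< m (const x) k<m)
    agree (above zero)  = *-congʳ (reflexive (≡.cong (λ j → ⟦ p ∣? j ⟧) (≡.sym (ℕ.+-identityʳ m))))
    agree (above (suc k)) = vanish (t^-⊛-+ m (const x) (suc k))

  -- The reciprocal of 1 - F when F has constant term zero.
  _^∞ : (ℕ → Carrier) → (ℕ → Carrier)
  F ^∞ = Defs.infiniteSum rawRing (λ k → F S.^ k)

  ^-vanishes : ∀ X → X 0 ≈ 0# → ∀ k {m} → m ℕ.< k → (X S.^ k) m ≈ 0#
  ^-vanishes X e (suc k) {zero} _ = trans (⊛-head X (X S.^ k)) (trans (*-congʳ e) (zeroˡ _))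
  ^-vanishes X e (suc k) {suc m} (ℕ.s≤s m<k) =
    trans (+-cong (trans (*-congʳ e) (zeroˡ _))
        (sum-zero {suc m} (λ i → trans
          (*-congˡ {X (suc (toℕ i))} (^-vanishes X e k (ℕ.≤-<-trans (ℕ.m∸n≤m m (toℕ i)) m<k)))
          (zeroʳ _))))
      (+-identityˡ _)

  -- Since `X` has no constant term, the coefficient of `X ⊛ (X ^∞)` in degree m involves `X ^∞`
  -- only below degree m, where the powers up to m - 1 suffice. Multiplied by `X`, these are the
  -- powers 1,...,m.
  ^∞-fixpoint : ∀ X → X 0 ≈ 0# → X ^∞ ≋ 𝟙 ⊞ (X ⊛ (X ^∞))
  ^∞-fixpoint X e m = +-congˡ (sym (trans (truncated m) (trans
      (S.*-distribˡ-sum {m} X (λ k → X S.^ toℕ k) m)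
      (reflexive (coeff-sum {m} (λ k → X S.^ suc (toℕ k)) m)))))
    where
    truncated : ∀ m → (X ⊛ (X ^∞)) m ≈ (X ⊛ S.sumUpTo m (X S.^_)) m
    truncated zero = +-congʳ (trans (*-congʳ e) (trans (zeroˡ _) (sym (trans (*-congʳ e) (zeroˡ _)))))
    truncated (suc m) = +-cong (trans (*-congʳ e) (trans (zeroˡ _) (sym (trans (*-congʳ e) (zeroˡ _)))))
      (sum-cong-≋ {suc m} (λ i → *-congˡ {X (suc (toℕ i))} (sym (trans
        (reflexive (coeff-sum {suc m} (λ k → X S.^ toℕ k) (m ∸ toℕ i)))
        (sumUpTo-truncate {suc (m ∸ toℕ i)} {suc m} (λ k → (X S.^ k) (m ∸ toℕ i))
          (ℕ.s≤s (ℕ.m∸n≤m m (toℕ i))) (λ k → ^-vanishes X e k))))))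

  head-* : ∀ {F G} → F 0 ≈ 1# → G 0 ≈ 1# → (F ⊛ G) 0 ≈ 1#
  head-* {F} {G} e e′ = trans (⊛-head F G) (trans (*-cong e e′) (*-identityˡ 1#))

  head-product : ∀ {n} (F : Fin n → ℕ → Carrier) → (∀ i → F i 0 ≈ 1#) → S.product F 0 ≈ 1#
  head-product {zero}  F e = refl
  head-product {suc n} F e = head-* {F zero} {S.product (F ∘ suc)} (e zero) (head-product (F ∘ suc) (e ∘ suc))

  head-1-t^ : ∀ m .{{_ : ℕ.NonZero m}} G → (𝟙 S.- (t S.^ m) ⊛ G) 0 ≈ 1#
  head-1-t^ m G = trans (-‿congˡ (t^-⊛-< m G (ℕ.>-nonZero⁻¹ m))) 1-0≈1

  inverse : ∀ D → D 0 ≈ 1# → D ⊛ ((𝟙 S.- D) ^∞) ≋ 𝟙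
  inverse D e = S.trans {D ⊛ G} {G ⊛ (𝟙 S.- X)} {𝟙}
    (S.trans {D ⊛ G} {G ⊛ D} {G ⊛ (𝟙 S.- X)} (⊛-comm D G) (⊛-cong {G} {G} {D} {𝟙 S.- X} (λ _ → refl) D≋))
    (S.geometric-inverse {X} {G} (^∞-fixpoint X (trans (+-congˡ (-‿cong e)) (-‿inverseʳ 1#))))
    where
    X = 𝟙 S.- D
    G = X ^∞
    D≋ : D ≋ 𝟙 S.- X
    D≋ k = sym (begin
      𝟙 k - (𝟙 k - D k)  ≈⟨ +-congˡ (⁻¹-anti-homo‿- (𝟙 k) (D k)) ⟩
      𝟙 k + (D k - 𝟙 k)  ≈⟨ +-assoc _ _ _ ⟨
      𝟙 k + D k - 𝟙 k    ≈⟨ xyx⁻¹≈y (𝟙 k) (D k) ⟩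
      D k                ∎)

  -- The expansion of t^b / (1 - t^m) for nonzero `m`, as `progression-*` shows.
  progression : ℕ → ℕ → (ℕ → Carrier)
  progression b m j = ⟦ Progression? b m j ⟧

  progression-t^ : ∀ b m → progression b m ≋ (t S.^ b) ⊛ progression 0 m
  progression-t^ b m j with split b j
  ... | below j<b = trans (reflexive (⟦⟧-no (Progression? b m j) (λ (b≤j , _) → ℕ.<⇒≱ j<b b≤j)))
                          (sym (t^-⊛-< b (progression 0 m) j<b))
  ... | above i = sym (trans (t^-⊛-+ b (progression 0 m) i)
        (reflexive (⟦⟧-⇔ (Progression? 0 m i) (mk⇔
          (λ (_ , m∣i) → ℕ.m≤m+n b i , ≡.subst (m ∣_) (≡.sym (ℕ.m+n∸m≡n b i)) m∣i)
          (λ (_ , m∣i) → ℕ.z≤n , ≡.subst (m ∣_) (ℕ.m+n∸m≡n b i) m∣i)) (Progression? b m (b ℕ.+ i)))))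

  progression-0-fixpoint : ∀ m .{{_ : ℕ.NonZero m}} →
                           progression 0 m ≋ 𝟙 ⊞ ((t S.^ m) ⊛ progression 0 m)
  progression-0-fixpoint m@(suc _) j with split m j
  progression-0-fixpoint m@(suc _) zero | below j<m =
    trans (reflexive (⟦⟧-yes (Progression? 0 m 0) (ℕ.z≤n , m ∣.∣0)))
      (sym (trans (+-congˡ (t^-⊛-< m (progression 0 m) j<m)) (+-identityʳ 1#)))
  progression-0-fixpoint m@(suc _) j@(suc _) | below j<m =
    trans (reflexive (⟦⟧-no (Progression? 0 m j) (λ (_ , m∣j) → ℕ.<⇒≱ j<m (∣.∣⇒≤ m∣j))))
      (sym (trans (+-congˡ (t^-⊛-< m (progression 0 m) j<m)) (+-identityʳ 0#)))
  progression-0-fixpoint m@(suc _) _ | above i = sym (begin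
    0# + ((t S.^ m) ⊛ progression 0 m) (m ℕ.+ i)
      ≈⟨ trans (+-identityˡ _) (t^-⊛-+ m (progression 0 m) i) ⟩
    progression 0 m i
      ≡⟨ ⟦⟧-⇔ (Progression? 0 m i) (mk⇔
           (λ (_ , m∣i) → ℕ.z≤n , ∣.∣m∣n⇒∣m+n ∣.∣-refl m∣i)
           (λ (_ , m∣m+i) → ℕ.z≤n , ∣.∣m+n∣m⇒∣n m∣m+i ∣.∣-refl)) (Progression? 0 m (m ℕ.+ i)) ⟩
    progression 0 m (m ℕ.+ i) ∎)

  progression-* : ∀ b m .{{_ : ℕ.NonZero m}} → progression b m ⊛ (𝟙 S.- (t S.^ m)) ≋ t S.^ b
  progression-* b m = begin′
    where
    P = progression 0 m
    U = 𝟙 S.- (t S.^ m)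
    begin′ : progression b m ⊛ U ≋ t S.^ b
    begin′ k = trans (⊛-cong {progression b m} {(t S.^ b) ⊛ P} {U} {U} (progression-t^ b m) (λ _ → refl) k)
      (trans (⊛-assoc (t S.^ b) P U k)
      (trans (⊛-cong {t S.^ b} {t S.^ b} {P ⊛ U} {𝟙} (λ _ → refl)
        (S.geometric-inverse {t S.^ m} {P} (progression-0-fixpoint m)) k)
        (S.*-identityʳ (t S.^ b) k)))

  module _ (q : Carrier) where

    -- The substitution t ↦ tq, read on coefficients.
    φ : (ℕ → Carrier) → (ℕ → Carrier)
    φ F k = q ^ k * F k

    φ-⊛ : ∀ F G → φ (F ⊛ G) ≋ φ F ⊛ φ G
    φ-⊛ F G k = trans (*-distribˡ-sum {suc k} (q ^ k) (λ i → F (toℕ i) * G (k ∸ toℕ i))) (sum-cong-≋ {suc k} (λ i → begin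
      q ^ k * (F (toℕ i) * G (k ∸ toℕ i))
        ≡⟨ ≡.cong (λ j → q ^ j * (F (toℕ i) * G (k ∸ toℕ i))) (ℕ.m+[n∸m]≡n (Fin.toℕ≤pred[n] i)) ⟨
      q ^ (toℕ i ℕ.+ (k ∸ toℕ i)) * (F (toℕ i) * G (k ∸ toℕ i))
        ≈⟨ *-congʳ (^-homo-* q (toℕ i) (k ∸ toℕ i)) ⟩
      q ^ toℕ i * q ^ (k ∸ toℕ i) * (F (toℕ i) * G (k ∸ toℕ i))
        ≈⟨ solve 4 (λ x y z u → (x :* y) :* (z :* u) := (x :* z) :* (y :* u)) refl _ _ _ _ ⟩
      q ^ toℕ i * F (toℕ i) * (q ^ (k ∸ toℕ i) * G (k ∸ toℕ i)) ∎))

    φ-const : ∀ x → φ (const x) ≋ const x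
    φ-const x zero    = *-identityˡ x
    φ-const x (suc k) = zeroʳ _

    φ-t : φ t ≋ t ⊛ const q
    φ-t k = trans (lemma k) (sym (⊛-comm t (const q) k))
      where
      lemma : ∀ k → φ t k ≈ (const q ⊛ t) k
      lemma zero          = trans (zeroʳ _) (sym (trans (constant-⊛ q t 0) (zeroʳ q)))
      lemma (suc zero)    = trans (*-congʳ (*-identityʳ q)) (sym (constant-⊛ q t 1))
      lemma (suc (suc k)) = trans (zeroʳ _) (sym (trans (constant-⊛ q t (suc (suc k))) (zeroʳ q)))

    φ-isRingHomomorphism : RingMorphisms.IsRingHomomorphism PowerSeries PowerSeries φ
    φ-isRingHomomorphism = record
      { isSemiringHomomorphism = record
        { isNearSemiringHomomorphism = record
          { +-isMonoidHomomorphism = record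
            { isMagmaHomomorphism = record
              { isRelHomomorphism = record { cong = λ e k → *-congˡ (e k) }
              ; homo = λ F G k → distribˡ _ _ _ }
            ; ε-homo = λ k → zeroʳ _ }
          ; *-homo = φ-⊛ }
        ; 1#-homo = φ-const 1# }
      ; -‿homo = λ F k → sym (-‿distribʳ-* _ _) }

-- Decreasing order with ties broken by position: existence and uniqueness.

module Sorting where
  open import Data.Nat.Base using (_+_; _≤_; _<_)
  open import Relation.Binary.PropositionalEquality using (refl; sym; trans; cong; subst; subst₂)

  module _ {N : ℕ} where

    -- s₀ and s₁ are positions holding the values x₀ and x₁.
    Before : (s₀ s₁ : Fin N) (x₀ x₁ : ℕ) → Set
    Before s₀ s₁ x₀ x₁ = x₁ < x₀ ⊎ x₁ ≡ x₀ × s₀ Fin.< s₁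

    before-trans : ∀ {s₀ s₁ s₂ x₀ x₁ x₂} → Before s₀ s₁ x₀ x₁ → Before s₁ s₂ x₁ x₂ → Before s₀ s₂ x₀ x₂
    before-trans (inj₁ x₁<x₀)         (inj₁ x₂<x₁)         = inj₁ (ℕ.<-trans x₂<x₁ x₁<x₀)
    before-trans (inj₁ x₁<x₀)         (inj₂ (refl , _))    = inj₁ x₁<x₀
    before-trans (inj₂ (refl , _))    (inj₁ x₂<x₁)         = inj₁ x₂<x₁
    before-trans (inj₂ (refl , s₀<s₁)) (inj₂ (refl , s₁<s₂)) = inj₂ (refl , ℕ.<-trans s₀<s₁ s₁<s₂)

    before-irrefl : ∀ {s₀ x₀} → ¬ Before s₀ s₀ x₀ x₀
    before-irrefl (inj₁ x<x)       = ℕ.<-irrefl refl x<x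
    before-irrefl (inj₂ (_ , s<s)) = ℕ.<-irrefl refl s<s

  Sorted : ∀ {m N} → Vector (Fin N) m → Vector ℕ m → Set
  Sorted σ x = ∀ {i j} → i Fin.< j → Before (σ i) (σ j) (x i) (x j)

  before-mono : ∀ {m n} (f : Fin m → Fin n) → (∀ {i j} → i Fin.< j → f i Fin.< f j) →
                ∀ {s₀ s₁ x₀ x₁} → Before s₀ s₁ x₀ x₁ → Before (f s₀) (f s₁) x₀ x₁
  before-mono f mono (inj₁ x₁<x₀)         = inj₁ x₁<x₀
  before-mono f mono (inj₂ (x₁≡x₀ , s₀<s₁)) = inj₂ (x₁≡x₀ , mono s₀<s₁)

  leader : ∀ {n} (x : Vector ℕ (suc n)) → ∃ λ m → ∀ j → j ≢ m → Before m j (x m) (x j)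
  leader {zero}  x = zero , λ { zero 0≢0 → contradiction refl 0≢0 }
  leader {suc n} x with leader (tail x)
  ... | m , m-leads with x (suc m) ℕ.≤? head x
  ...   | no x₀<xₘ = suc m , λ
    { zero    _     → inj₁ (ℕ.≰⇒> x₀<xₘ)
    ; (suc j) j≢m → before-mono suc ℕ.s≤s (m-leads j (j≢m ∘ cong suc)) }
  ...   | yes xₘ≤x₀ = zero , λ
    { zero    0≢0 → contradiction refl 0≢0
    ; (suc j) _   → leads j }
    where
    -- A tie goes to position zero, which precedes all others.
    zero-leads-m : Before zero (suc m) (head x) (x (suc m))
    zero-leads-m = [ inj₁ , (λ e → inj₂ (e , ℕ.s≤s ℕ.z≤n)) ]′ (ℕ.m≤n⇒m<n∨m≡n xₘ≤x₀)
    leads : ∀ j → Before zero (suc j) (head x) (x (suc j))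
    leads j with j Fin.≟ m
    ... | yes refl = zero-leads-m
    ... | no  j≢m  = before-trans zero-leads-m (before-mono suc ℕ.s≤s (m-leads j j≢m))

  punchIn-mono-< : ∀ {n} (m : Fin (suc n)) {i j : Fin n} → i Fin.< j → punchIn m i Fin.< punchIn m j
  punchIn-mono-< m {i} {j} i<j = ℕ.≤∧≢⇒< (Fin.punchIn-mono-≤ m i j (ℕ.<⇒≤ i<j))
    (λ e → ℕ.<⇒≢ i<j (cong toℕ (Fin.punchIn-injective m i j (Fin.toℕ-injective e))))

  -- Selection sort: the leader goes first and the rest is sorted recursively. `punchIn m` is
  -- monotone, so ties among the rest remain broken by position.
  sort : ∀ {n} (x : Vector ℕ n) → ∃ λ (σ : Permutation′ n) → Sorted (σ ⟨$⟩ʳ_) (x ∘ (σ ⟨$⟩ʳ_))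
  sort {zero}  x = Perm.id , λ { {()} }
  sort {suc n} x with leader x
  ... | m , m-leads with sort (x ∘ punchIn m)
  ...   | σ , σ-sorted = Perm.insert zero m σ , sorted
    where
    σ⁺ = Perm.insert zero m σ ⟨$⟩ʳ_
    σ⁺-suc : ∀ j → punchIn m (σ ⟨$⟩ʳ j) ≡ σ⁺ (suc j)
    σ⁺-suc j = sym (Perm.insert-punchIn zero m σ j)
    sorted : Sorted σ⁺ (x ∘ σ⁺)
    sorted {zero}  {suc j} _ =
      subst (λ k → Before m k (x m) (x k)) (σ⁺-suc j) (m-leads _ (Fin.punchInᵢ≢i m _))
    sorted {suc i} {suc j} (ℕ.s≤s i<j) =
      subst₂ (λ k l → Before k l (x k) (x l)) (σ⁺-suc i) (σ⁺-suc j)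
        (before-mono (punchIn m) (punchIn-mono-< m) (σ-sorted i<j))

  -- The lower bound `b` rises by one on passing to the tail, because all later values exceed the
  -- first.
  inflationary : ∀ {m} (f : Fin m → ℕ) b → (∀ {i j} → i Fin.< j → f i < f j) → (∀ i → b ≤ f i) →
                 ∀ i → b + toℕ i ≤ f i
  inflationary f b mono b≤f zero    = ℕ.≤-trans (ℕ.≤-reflexive (ℕ.+-identityʳ b)) (b≤f zero)
  inflationary f b mono b≤f (suc i) = ℕ.≤-trans (ℕ.≤-reflexive (ℕ.+-suc b (toℕ i)))
    (inflationary (f ∘ suc) (suc b) (mono ∘ ℕ.s≤s) (λ j → ℕ.≤-<-trans (b≤f zero) (mono (ℕ.s≤s ℕ.z≤n))) i)

  -- The map σ⁻¹τ is strictly increasing, as an inversion or a coincidence would make some position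
  -- come before itself; so it is inflationary.
  sorted-≤ : ∀ {n} (x : Vector ℕ n) (σ τ : Permutation′ n) →
             Sorted (σ ⟨$⟩ʳ_) (x ∘ (σ ⟨$⟩ʳ_)) → Sorted (τ ⟨$⟩ʳ_) (x ∘ (τ ⟨$⟩ʳ_)) →
             ∀ i → i Fin.≤ σ ⟨$⟩ˡ (τ ⟨$⟩ʳ i)
  sorted-≤ x σ τ σ-sorted τ-sorted = inflationary (toℕ ∘ ρ) 0 mono (λ _ → ℕ.z≤n)
    where
    ρ = λ i → σ ⟨$⟩ˡ (τ ⟨$⟩ʳ i)
    mono : ∀ {i j} → i Fin.< j → ρ i Fin.< ρ j
    mono {i} {j} i<j with Fin.<-cmp (ρ i) (ρ j)
    ... | tri< ρi<ρj _ _ = ρi<ρj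
    ... | tri≈ _ ρi≡ρj _ = contradiction
      (subst (λ k → Before k (τ ⟨$⟩ʳ j) (x k) (x (τ ⟨$⟩ʳ j)))
        (trans (sym (Perm.inverseʳ σ)) (trans (cong (σ ⟨$⟩ʳ_) ρi≡ρj) (Perm.inverseʳ σ))) (τ-sorted i<j))
      before-irrefl
    ... | tri> _ _ ρj<ρi = contradiction
      (before-trans (τ-sorted i<j)
        (subst₂ (λ k l → Before k l (x k) (x l)) (Perm.inverseʳ σ) (Perm.inverseʳ σ) (σ-sorted ρj<ρi)))
      before-irrefl

  -- Both σ⁻¹τ and its inverse τ⁻¹σ are inflationary, which forces them to be the identity.
  sort-unique : ∀ {n} (x : Vector ℕ n) (σ τ : Permutation′ n) →
                Sorted (σ ⟨$⟩ʳ_) (x ∘ (σ ⟨$⟩ʳ_)) → Sorted (τ ⟨$⟩ʳ_) (x ∘ (τ ⟨$⟩ʳ_)) → τ Perm.≈ σ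
  sort-unique x σ τ σ-sorted τ-sorted i = trans (sym (Perm.inverseʳ σ)) (cong (σ ⟨$⟩ʳ_)
    (Fin.≤-antisym
      (subst (σ ⟨$⟩ˡ (τ ⟨$⟩ʳ i) Fin.≤_) (trans (cong (τ ⟨$⟩ˡ_) (Perm.inverseʳ σ)) (Perm.inverseˡ τ))
        (sorted-≤ x τ σ τ-sorted σ-sorted (σ ⟨$⟩ˡ (τ ⟨$⟩ʳ i))))
      (sorted-≤ x σ τ σ-sorted τ-sorted i)))

-- Chains: sequences lying above the minimal one, described by neighbouring entries.

module Chains (r d s N : ℕ) .{{r≢0 : NonZero r}} .{{d≢0 : NonZero d}} (s*d≡r : s ℕ.* d ≡ r) where
  open import Data.Nat.Base using (_+_; _*_; _≤_)
  open import Relation.Binary.PropositionalEquality using (refl; sym; trans; cong; subst; subst₂)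
  open Congruences
  open Sorting

  Descent? : (c₀ c₁ : Fin r) (s₀ s₁ : Fin N) → Dec (c₀ ≡ c₁ × s₀ Fin.> s₁)
  Descent? c₀ c₁ s₀ s₁ = (c₀ Fin.≟ c₁) ×-dec (s₁ Fin.<? s₀)

  descent : (c₀ c₁ : Fin r) (s₀ s₁ : Fin N) → ℕ
  descent c₀ c₁ s₀ s₁ = if does (Descent? c₀ c₁ s₀ s₁) then 1 else 0

  colourStep : (c₀ c₁ : Fin r) → ℕ
  colourStep c₀ c₁ = (pos (toℕ c₀) ℤ.- pos (toℕ c₁)) %ℕ r

  -- The difference λᵢ - λᵢ₊₁: `r` times the drop of h plus the drop of k.
  gap : (c₀ c₁ : Fin r) (s₀ s₁ : Fin N) → ℕ
  gap c₀ c₁ s₀ s₁ = r * descent c₀ c₁ s₀ s₁ + colourStep c₀ c₁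

  Step : (c₀ c₁ : Fin r) (s₀ s₁ : Fin N) (x₀ x₁ : ℕ) → Set
  Step c₀ c₁ s₀ s₁ x₀ x₁ = x₁ ≤ x₀ × Progression (gap c₀ c₁ s₀ s₁) r (x₀ ∸ x₁)

  colourStep-mod : ∀ c₀ c₁ → colourStep c₀ c₁ + toℕ c₁ ≡ toℕ c₀ [mod r ]
  colourStep-mod c₀ c₁ = mod-difference (toℕ c₀) (toℕ c₁)

  colourStep≡0⇒≡ : ∀ c₀ c₁ → colourStep c₀ c₁ ≡ 0 → c₀ ≡ c₁
  colourStep≡0⇒≡ c₀ c₁ e = Fin.toℕ-injective (sym (mod-<⇒≡ (Fin.toℕ<n c₁) (Fin.toℕ<n c₀)
    (subst (λ z → z + toℕ c₁ ≡ toℕ c₀ [mod r ]) e (colourStep-mod c₀ c₁))))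

  colourStep-refl : ∀ c → colourStep c c ≡ 0
  colourStep-refl c = mod-<⇒≡ (n%ℕd<d (pos (toℕ c) ℤ.- pos (toℕ c)) r) (ℕ.>-nonZero⁻¹ r)
    (mod-cancelʳ {r} {colourStep c c} {0} (toℕ c) (colourStep-mod c c))

  -- If the two values tie, the gap is zero. Then the colours agree and there is no descent, so the
  -- distinct positions increase.
  step⇒before : ∀ {c₀ c₁ s₀ s₁ x₀ x₁} → s₀ ≢ s₁ → Step c₀ c₁ s₀ s₁ x₀ x₁ → Before s₀ s₁ x₀ x₁
  step⇒before {c₀} {c₁} {s₀} {s₁} {x₀} {x₁} s₀≢s₁ (x₁≤x₀ , gap≤ , _) with ℕ.<-cmp x₁ x₀
  ... | tri< x₁<x₀ _ _ = inj₁ x₁<x₀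
  ... | tri> _ _ x₀<x₁ = contradiction x₁≤x₀ (ℕ.<⇒≱ x₀<x₁)
  ... | tri≈ _ refl _ = inj₂ (refl , tie)
    where
    gap≡0 : gap c₀ c₁ s₀ s₁ ≡ 0
    gap≡0 = ℕ.n≤0⇒n≡0 (ℕ.≤-trans gap≤ (ℕ.≤-reflexive (ℕ.n∸n≡0 x₁)))
    c₀≡c₁ : c₀ ≡ c₁
    c₀≡c₁ = colourStep≡0⇒≡ c₀ c₁ (ℕ.m+n≡0⇒n≡0 _ gap≡0)
    no-descent : (D? : Dec (c₀ ≡ c₁ × s₀ Fin.> s₁)) → r * (if does D? then 1 else 0) ≡ 0 →
                 ¬ (c₀ ≡ c₁ × s₀ Fin.> s₁)
    no-descent (yes _) r*1≡0 _ = ℕ.≢-nonZero⁻¹ r (trans (sym (ℕ.*-identityʳ r)) r*1≡0)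
    no-descent (no ¬D) _     D = ¬D D
    tie : s₀ Fin.< s₁
    tie with Fin.<-cmp s₀ s₁
    ... | tri< s₀<s₁ _ _ = s₀<s₁
    ... | tri≈ _ s₀≡s₁ _ = contradiction s₀≡s₁ s₀≢s₁
    ... | tri> _ _ s₀>s₁ = contradiction (c₀≡c₁ , s₀>s₁)
      (no-descent (Descent? c₀ c₁ s₀ s₁) (ℕ.m+n≡0⇒m≡0 _ gap≡0))

  step⇒mod : ∀ {c₀ c₁ s₀ s₁ x₀ x₁} → Step c₀ c₁ s₀ s₁ x₀ x₁ → x₀ + toℕ c₁ ≡ x₁ + toℕ c₀ [mod r ]
  step⇒mod {c₀} {c₁} {s₀} {s₁} {x₀} {x₁} (x₁≤x₀ , step) with progression⇒ step
  ... | k , e = subst (λ x → x + toℕ c₁ ≡ x₁ + toℕ c₀ [mod r ]) (ℕ.m+[n∸m]≡n x₁≤x₀)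
    (subst (λ x → x₁ + x + toℕ c₁ ≡ x₁ + toℕ c₀ [mod r ]) (sym e)
    (mod-trans (mod-reflexive (rearrange x₁ r b (colourStep c₀ c₁) k (toℕ c₁)))
    (mod-trans (mod-multiple _ (b + k)) (mod-+ (mod-refl {a = x₁}) (colourStep-mod c₀ c₁)))))
    where
    b = descent c₀ c₁ s₀ s₁
    rearrange : ∀ x r b ε k c → x + (r * b + ε + k * r) + c ≡ x + (ε + c) + (b + k) * r
    rearrange = solve-∀

  -- The difference `w` is congruent to `colourStep c₀ c₁`, which is below `r`, hence exceeds it by
  -- a multiple of `r`. At a descent this multiple has to be positive.
  ⇒step : ∀ {c₀ c₁ s₀ s₁ x₀ x₁} → Before s₀ s₁ x₀ x₁ → x₀ + toℕ c₁ ≡ x₁ + toℕ c₀ [mod r ] →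
          Step c₀ c₁ s₀ s₁ x₀ x₁
  ⇒step {c₀} {c₁} {s₀} {s₁} {x₀} {x₁} before e = x₁≤x₀ , progress (Descent? c₀ c₁ s₀ s₁)
    where
    x₁≤x₀ : x₁ ≤ x₀
    x₁≤x₀ = [ ℕ.<⇒≤ , ℕ.≤-reflexive ∘ proj₁ ]′ before
    w = x₀ ∸ x₁
    ε = colourStep c₀ c₁
    rearrange : ∀ w c x → w + c + x ≡ (x + w) + c
    rearrange = solve-∀
    w≡ε : w ≡ ε [mod r ]
    w≡ε = mod-cancelʳ (toℕ c₁) (mod-trans
      (mod-cancelʳ {a = w + toℕ c₁} {b = toℕ c₀} x₁ (mod-trans
        (mod-reflexive (trans (rearrange w (toℕ c₁) x₁) (cong (_+ toℕ c₁) (ℕ.m+[n∸m]≡n x₁≤x₀))))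
        (mod-trans e (mod-reflexive (ℕ.+-comm x₁ (toℕ c₀))))))
      (mod-sym (colourStep-mod c₀ c₁)))
    w%r≡ε : w % r ≡ ε
    w%r≡ε = trans (mod⇒% w≡ε) (m<n⇒m%n≡m (n%ℕd<d (pos (toℕ c₀) ℤ.- pos (toℕ c₁)) r))
    base : Progression ε r w
    base = %-progression r ε w%r≡ε
    one-period : ∀ ε r k → ε + (r + k * r) ≡ r * 1 + ε + k * r
    one-period = solve-∀
    advance : c₀ ≡ c₁ → s₀ Fin.> s₁ → (∃ λ k → w ≡ ε + k * r) → Progression (r * 1 + ε) r w
    advance c₀≡c₁ s₀>s₁ (suc k , w≡) =
      subst (Progression (r * 1 + ε) r) (sym (trans w≡ (one-period ε r k))) (⇒progression (r * 1 + ε) r k)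
    -- Equal colours give ε = 0, so the values would tie, and `before` would then put the positions
    -- in increasing order, against the descent.
    advance c₀≡c₁ s₀>s₁ (zero , w≡) = contradiction before λ
      { (inj₁ x₁<x₀)       → ℕ.<⇒≢ (ℕ.m<n⇒0<n∸m x₁<x₀) (sym w≡0)
      ; (inj₂ (_ , s₀<s₁)) → ℕ.<-asym s₀<s₁ s₀>s₁ }
      where
      w≡0 : w ≡ 0
      w≡0 = trans w≡ (trans (ℕ.+-identityʳ ε)
        (trans (cong (λ c → colourStep c c₁) c₀≡c₁) (colourStep-refl c₁)))
    progress : (D? : Dec (c₀ ≡ c₁ × s₀ Fin.> s₁)) →
               Progression (r * (if does D? then 1 else 0) + ε) r w
    progress (no _) = subst (λ z → Progression (z + ε) r w) (sym (ℕ.*-zeroʳ r)) base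
    progress (yes (c₀≡c₁ , s₀>s₁)) = advance c₀≡c₁ s₀>s₁ (progression⇒ base)

  -- x = λ + μ, where λ is the minimal sequence of the colours c and the positions σ, and μ is decreasing with
  -- differences divisible by r and last entry divisible by d.
  Chain : ∀ {m} → Vector (Fin r) (suc m) → Vector (Fin N) (suc m) → Vector ℕ (suc m) → Set
  Chain {zero}  c σ x = Progression (toℕ (c zero) % d) d (x zero)
  Chain {suc m} c σ x =
    Step (c zero) (c (suc zero)) (σ zero) (σ (suc zero)) (x zero) (x (suc zero)) ×
    Chain (tail c) (tail σ) (tail x)

  Chain? : ∀ {m} c σ x → Dec (Chain {m} c σ x)
  Chain? {zero}  c σ x = Progression? _ d _
  Chain? {suc m} c σ x = ((_ ℕ.≤? _) ×-dec Progression? _ r _) ×-dec Chain? (tail c) (tail σ) (tail x)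

  -- The colours c represent the residues of x modulo r, up to the action of C_s.
  Coloured : ∀ {m} → Vector (Fin r) m → Vector ℕ m → Set
  Coloured c x = ∃ λ J → ∀ i → x i ≡ toℕ (c i) + J * d [mod r ]

  -- A chain constrains neighbours only; transitivity of `Before` reaches the other pairs.
  chain⇒sorted : ∀ {m c σ x} → (∀ {i j} → σ i ≡ σ j → i ≡ j) → Chain {m} c σ x → Sorted σ x
  chain⇒sorted {zero} inj _ {zero} {zero} ()
  chain⇒sorted {suc m} inj (step , chain) {suc i} {suc j} (ℕ.s≤s i<j) =
    chain⇒sorted (Fin.suc-injective ∘ inj) chain i<j
  chain⇒sorted {suc m} {c} inj (step , chain) {zero} {suc zero} _ =
    step⇒before {c zero} {c (suc zero)} (Fin.0≢1+n ∘ inj) step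
  chain⇒sorted {suc m} {c} inj (step , chain) {zero} {suc (suc j)} _ = before-trans
    (step⇒before {c zero} {c (suc zero)} (Fin.0≢1+n ∘ inj) step)
    (chain⇒sorted (Fin.suc-injective ∘ inj) chain {zero} {suc j} (ℕ.s≤s ℕ.z≤n))

  -- Multiplication by s - 1 negates the multiples of d modulo r = s d.
  negate-multiple : ∀ k → k * d + k * ℕ.pred s * d ≡ 0 [mod r ]
  negate-multiple k = mod-by 0 k (trans (ℕ.+-identityʳ _) (begin
    k * d + k * ℕ.pred s * d   ≡⟨ rearrange k (ℕ.pred s) d ⟩
    k * (suc (ℕ.pred s) * d)   ≡⟨ cong (λ z → k * (z * d)) (ℕ.suc-pred s {{s≢0}}) ⟩
    k * (s * d)                ≡⟨ cong (k *_) s*d≡r ⟩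
    k * r                      ∎))
    where
    open ≡.≡-Reasoning
    rearrange : ∀ k s d → k * d + k * s * d ≡ k * (suc s * d)
    rearrange = solve-∀
    s≢0 : NonZero s
    s≢0 = ℕ.m*n≢0⇒m≢0 s {{ℕ.≢-nonZero (λ e → ℕ.≢-nonZero⁻¹ r (trans (sym s*d≡r) e))}}

  d∣r : d ∣ r
  d∣r = divides s (sym s*d≡r)

  -- The last entry determines the shift `J`. A step has x₀ - x₁ congruent to c₀ - c₁ modulo r, so
  -- the same `J` serves all earlier entries.
  chain⇒coloured : ∀ {m c σ x} → Chain {m} c σ x → Coloured c x
  chain⇒coloured {zero} {c} {σ} {x} chain with progression⇒ chain
  -- The entry is ρ + kd and its colour ρ + k′d with ρ the common residue, so J should be k - k′;
  -- multiplying k′ by s - 1 gives its negative.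
  ... | k , e = k + k′ * ℕ.pred s , λ { zero → mod-sym (mod-trans
        (mod-reflexive (trans (cong (_+ (k + k′ * ℕ.pred s) * d) (m≡m%n+[m/n]*n (toℕ (c zero)) d))
          (rearrange (toℕ (c zero) % d) k′ d k (ℕ.pred s))))
        (mod-trans (mod-+ (mod-refl {a = toℕ (c zero) % d + k * d}) (negate-multiple k′))
          (mod-reflexive (trans (ℕ.+-identityʳ _) (sym e))))) }
    where
    k′ = toℕ (c zero) / d
    rearrange : ∀ ρ k′ d k s → ρ + k′ * d + (k + k′ * s) * d ≡ ρ + k * d + (k′ * d + k′ * s * d)
    rearrange = solve-∀
  chain⇒coloured {suc m} {c} {σ} {x} (step , chain) with chain⇒coloured chain
  ... | J , e = J , λ
    { zero → mod-cancelʳ (toℕ c₁) (mod-trans (step⇒mod {c zero} {c₁} {σ zero} {σ (suc zero)} step) (mod-trans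
        (mod-+ (e zero) (mod-refl {a = toℕ (c zero)}))
        (mod-reflexive (rearrange (toℕ c₁) (J * d) (toℕ (c zero))))))
    ; (suc i) → e i }
    where
    c₁ = c (suc zero)
    rearrange : ∀ x y z → x + y + z ≡ z + y + x
    rearrange = solve-∀

  ⇒chain : ∀ {m c σ x} → Sorted σ x → Coloured c x → Chain {m} c σ x
  ⇒chain {zero} {c} {σ} {x} sorted (J , e) = %-progression d _
    (mod⇒% (mod-trans (mod-weaken d∣r (e zero)) (mod-multiple _ J)))
  ⇒chain {suc m} {c} {σ} {x} sorted (J , e) =
    ⇒step (sorted {zero} {suc zero} (ℕ.s≤s ℕ.z≤n)) (mod-trans
      (mod-+ (e zero) (mod-refl {a = toℕ (c (suc zero))}))
      (mod-trans (mod-reflexive (rearrange (toℕ (c zero)) (J * d) (toℕ (c (suc zero)))))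
        (mod-+ (mod-sym (e (suc zero))) (mod-refl {a = toℕ (c zero)})))) ,
    ⇒chain (λ i<j → sorted (ℕ.s≤s i<j)) (J , e ∘ suc)
    where
    rearrange : ∀ x y z → x + y + z ≡ z + y + x
    rearrange = solve-∀

  -- Multiples of `d` disappear, so the exponent of a is the same for all f attached to g; it is
  -- `col g`.
  chain⇒residue : ∀ {m c σ x} → Chain {m} c σ x → ∀ i → x i % d ≡ toℕ (c i) % d
  chain⇒residue {σ = σ} chain i with chain⇒coloured {σ = σ} chain
  ... | J , e = mod⇒% (mod-trans (mod-weaken d∣r (e i)) (mod-multiple _ J))

  chain-resp-≗ : ∀ {m} c σ {x y} → x ≗ y → Chain {m} c σ x → Chain c σ y
  chain-resp-≗ {zero}  c σ e chain = subst (Progression (toℕ (c zero) % d) d) (e zero) chain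
  chain-resp-≗ {suc m} c σ e (step , chain) =
    subst₂ (Step (c zero) (c (suc zero)) (σ zero) (σ (suc zero))) (e zero) (e (suc zero)) step ,
    chain-resp-≗ (tail c) (tail σ) (e ∘ suc) chain

-- The vectors attached to a coset, and its minimal sequence.

module Fibres (r p s n : ℕ) .{{r≢0 : NonZero r}} .{{s≢0 : NonZero s}}
  (p∣r : p ∣ r) (s∣r : s ∣ r) (ps∣rn : p ℕ.* s ∣ r ℕ.* suc n) where
  open import Data.Nat.Base using (_+_; _*_)
  open import Relation.Binary.PropositionalEquality using (refl; sym; trans; cong; cong₂; subst; subst₂)
  open Congruences
  open Sorting
  module ℕ-Sum = MonoidSum ℕ.+-0-commutativeMonoid

  open ColouredPermutationGroups r p s (suc n) s∣r

  d : ℕ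
  d = r / s

  instance
    d≢0 : NonZero d
    d≢0 = r/s≢0 r s s∣r

  open Chains r d s (suc n) (m*[n/m]≡n s∣r) public

  -- Cancelling `s` after writing r = sd. It makes a shift of all colours by a multiple of `d`
  -- invisible in their sum modulo `p`.
  p∣n*d : p ∣ suc n * d
  p∣n*d = ∣.*-cancelʳ-∣ s (subst (p * s ∣_) (trans (cong (_* suc n) (sym (m*[n/m]≡n s∣r))) (rearrange s d (suc n))) ps∣rn)
    where
    rearrange : ∀ s d n → s * d * n ≡ n * d * s
    rearrange = solve-∀

  colours : G[r,p,n] → Vector (Fin r) (suc n)
  colours g = colour (element g)

  places : G[r,p,n] → Vector (Fin (suc n)) (suc n)
  places g i = perm (element g) ⟨$⟩ʳ i

  Fibre : G[r,p,n] → Vector ℕ (suc n) → Set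
  Fibre g f = Chain (colours g) (places g) (f ∘ places g)

  Fibre? : ∀ g f → Dec (Fibre g f)
  Fibre? g f = Chain? (colours g) (places g) (f ∘ places g)

  generator^-perm : ∀ j i → perm (generator^ j) ⟨$⟩ʳ i ≡ i
  generator^-perm zero    i = refl
  generator^-perm (suc j) i = generator^-perm j i

  generator^-colour : ∀ j i → toℕ (colour (generator^ j) i) ≡ j * d [mod r ]
  generator^-colour zero    i = toℕ-mod 0 r
  generator^-colour (suc j) i = mod-trans (toℕ-mod _ r)
    (subst (λ x → toℕ (colour (generator^ j) i) + toℕ (d mod r) ≡ x [mod r ]) (ℕ.+-comm (j * d) d)
      (mod-+ (generator^-colour j i) (toℕ-mod d r)))

  ∙-generator^-colour : ∀ g j i → toℕ (colour (g ∙ generator^ j) i) ≡ toℕ (colour g i) + j * d [mod r ]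
  ∙-generator^-colour g j i = mod-trans (toℕ-mod _ r)
    (subst (λ x → toℕ (colour (generator^ j) i) + toℕ (colour g x) ≡ toℕ (colour g i) + j * d [mod r ])
      (sym (generator^-perm j i))
      (subst (λ x → toℕ (colour (generator^ j) i) + toℕ (colour g i) ≡ x [mod r ])
        (ℕ.+-comm (j * d) (toℕ (colour g i)))
        (mod-+ (generator^-colour j i) (mod-refl {a = toℕ (colour g i)}))))

  ∼⇒shift : ∀ {g h} → g ∼ h →
    (∃ λ j → ∀ i → toℕ (colours h i) ≡ toℕ (colours g i) + j * d [mod r ]) × (∀ i → places h i ≡ places g i)
  ∼⇒shift {g} {h} (j , eᶜ , eᵖ) =
    (j , λ i → subst (λ x → toℕ x ≡ toℕ (colours g i) + j * d [mod r ]) (sym (eᶜ i))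
                 (∙-generator^-colour (element g) j i)) ,
    λ i → trans (eᵖ i) (cong (places g) (generator^-perm j i))

  shift⇒∼ : ∀ {g h} j → (∀ i → toℕ (colours h i) ≡ toℕ (colours g i) + j * d [mod r ]) →
            (∀ i → places h i ≡ places g i) → g ∼ h
  shift⇒∼ {g} {h} j eᶜ eᵖ = j ,
    (λ i → Fin.toℕ-injective (mod-<⇒≡ (Fin.toℕ<n _) (Fin.toℕ<n _)
      (mod-trans (eᶜ i) (mod-sym (∙-generator^-colour (element g) j i))))) ,
    λ i → trans (eᵖ i) (cong (places g) (sym (generator^-perm j i)))

  places-injective : ∀ g {i j} → places g i ≡ places g j → i ≡ j
  places-injective g e = trans (sym (Perm.inverseˡ (perm (element g))))
    (trans (cong (perm (element g) ⟨$⟩ˡ_) e) (Perm.inverseˡ (perm (element g))))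

  fibre⇒sorted : ∀ g f → Fibre g f → Sorted (places g) (f ∘ places g)
  fibre⇒sorted g f = chain⇒sorted {c = colours g} (places-injective g)

  fibre⇒coloured : ∀ g f → Fibre g f → Coloured (colours g) (f ∘ places g)
  fibre⇒coloured g f = chain⇒coloured {σ = places g}

  -- The new representative has the same permutation and colours larger by jd, which is offset by
  -- replacing J with J - j, that is, J + j(s - 1).
  fibre-resp-∼ : ∀ {g h} f → g ∼ h → Fibre g f → Fibre h f
  fibre-resp-∼ {g} {h} f g∼h fibre =
    let ((j , eᶜ) , eᵖ) = ∼⇒shift {g} {h} g∼h
        (J , e)         = fibre⇒coloured g f fibre
    in ⇒chain
    (λ {i} {i′} i<i′ → subst₂ (λ k l → Before k l (f k) (f l)) (sym (eᵖ i)) (sym (eᵖ i′)) (fibre⇒sorted g f fibre i<i′))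
    (J + j * ℕ.pred s , λ i → subst (λ k → f k ≡ toℕ (colours h i) + (J + j * ℕ.pred s) * d [mod r ]) (sym (eᵖ i))
      (mod-trans (e i) (mod-sym (mod-trans (mod-+ (eᶜ i) (mod-refl {a = (J + j * ℕ.pred s) * d}))
        (mod-trans (mod-reflexive (rearrange (toℕ (colours g i)) j J (ℕ.pred s) d))
        (mod-trans (mod-+ (mod-refl {a = toℕ (colours g i) + J * d}) (negate-multiple j)) (mod-reflexive (ℕ.+-identityʳ _))))))))
    where
    rearrange : ∀ c j J s d → c + j * d + (J + j * s) * d ≡ c + J * d + (j * d + j * s * d)
    rearrange = solve-∀

  -- `f` determines the sorting permutation. Both colourings then represent `f` along it, up to Jd
  -- and J′d, so they differ by (J - J′)d.
  fibre-unique : ∀ {g h} f → Fibre g f → Fibre h f → g ∼ h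
  fibre-unique {g} {h} f fibreᵍ fibreʰ =
    let (J  , e)  = fibre⇒coloured g f fibreᵍ
        (J′ , e′) = fibre⇒coloured h f fibreʰ
    in shift⇒∼ {g} {h} (J + J′ * ℕ.pred s)
    (λ i → mod-sym (mod-cancelʳ (J′ * d)
      (mod-trans (mod-reflexive (rearrange (toℕ (colours g i)) J J′ (ℕ.pred s) d))
      (mod-trans (mod-+ (mod-sym (e i)) (negate-multiple J′))
      (mod-trans (mod-reflexive (trans (ℕ.+-identityʳ _) (cong f (sym (same-places i))))) (e′ i))))))
    same-places
    where
    same-places = sort-unique f (perm (element g)) (perm (element h))
      (fibre⇒sorted g f fibreᵍ) (fibre⇒sorted h f fibreʰ)
    rearrange : ∀ c J J′ s d → c + (J + J′ * s) * d + J′ * d ≡ c + J * d + (J′ * d + J′ * s * d)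
    rearrange = solve-∀

  sumℕ-places : ∀ (σ : Permutation′ (suc n)) (f : Vector ℕ (suc n)) → sumℕ (f ∘ (σ ⟨$⟩ʳ_)) ≡ sumℕ f
  sumℕ-places σ f = sym (ℕ-Sum.sum-permute f σ)

  -- Modulo `p`, the sum of `f` is the colour sum of `g` plus J times `suc n * d`; `p` divides both.
  fibre⇒p∣sum : ∀ g f → Fibre g f → p ∣ sumℕ f
  fibre⇒p∣sum g f fibre =
    let (J , e) = fibre⇒coloured g f fibre in subst (p ∣_) (sumℕ-places (perm (element g)) f)
    (mod-∣ (mod-sym (sumℕ-mod (f ∘ places g) (λ i → toℕ (colours g i) + J * d) (λ i → mod-weaken p∣r (e i))))
      (subst (p ∣_) (sym (sumℕ-+-const (toℕ ∘ colours g) (J * d)))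
        (∣.∣m∣n⇒∣m+n (p∣colours g) (subst (p ∣_) (rearrange J (suc n) d) (∣.∣n⇒∣m*n J p∣n*d)))))
    where
    rearrange : ∀ J n d → J * (n * d) ≡ n * (J * d)
    rearrange = solve-∀

  -- With the residues of the sorted `f` as colours, the shift J = 0 works, and the colour sum is
  -- congruent to that of `f` modulo `p` because p ∣ r.
  fibre-exists : ∀ f → p ∣ sumℕ f → ∃ λ g → Fibre g f
  fibre-exists f p∣f =
    let (σ , sorted) = sort f in record { element = (λ i → f (σ ⟨$⟩ʳ i) mod r) ⨾ σ ; p∣colours =
      mod-∣ (mod-sym (sumℕ-mod (λ i → toℕ (f (σ ⟨$⟩ʳ i) mod r)) (f ∘ (σ ⟨$⟩ʳ_))
        (λ i → mod-weaken p∣r (toℕ-mod (f (σ ⟨$⟩ʳ i)) r))))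
      (subst (p ∣_) (sym (sumℕ-places σ f)) p∣f) } ,
    ⇒chain sorted (0 , λ i → mod-sym (mod-trans (mod-reflexive (ℕ.+-identityʳ _)) (toℕ-mod (f (σ ⟨$⟩ʳ i)) r)))

  -- The sequence λ₁(g), …, λₙ(g), built up from its last entry.
  minimum : ∀ {m} → Vector (Fin r) (suc m) → Vector (Fin (suc n)) (suc m) → Vector ℕ (suc m)
  minimum {zero}  c σ zero    = toℕ (c zero) % d
  minimum {suc m} c σ zero    =
    minimum (tail c) (tail σ) zero + gap (c zero) (c (suc zero)) (σ zero) (σ (suc zero))
  minimum {suc m} c σ (suc i) = minimum (tail c) (tail σ) i

  length-filter-tabulate : ∀ {a p} {A : Set a} {P : A → Set p} (P? : ∀ x → Dec (P x)) {n} (f : Fin n → A) →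
    length (filter P? (tabulate f)) ≡ sumℕ (λ i → if does (P? (f i)) then 1 else 0)
  length-filter-tabulate P? {zero}  f = refl
  length-filter-tabulate P? {suc n} f with P? (f zero)
  ... | yes _ = cong suc (length-filter-tabulate P? (f ∘ suc))
  ... | no  _ = length-filter-tabulate P? (f ∘ suc)

  module _ {m} (c : Vector (Fin r) m) (σ : Vector (Fin (suc n)) m) where

    -- `HDes` for vectors of any length, so that descents can be counted by induction along the
    -- tail.
    DescentAt : Fin m → Set
    DescentAt i = ∃ λ i⁺ → toℕ i⁺ ≡ suc (toℕ i) × c i ≡ c i⁺ × σ i Fin.> σ i⁺

    DescentAt? : ∀ i → Dec (DescentAt i)
    DescentAt? i = Fin.any? λ i⁺ →
      (toℕ i⁺ ℕ.≟ suc (toℕ i)) ×-dec (c i Fin.≟ c i⁺) ×-dec (σ i⁺ Fin.<? σ i)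

    DescentFrom? : (i j : Fin m) → Dec (i Fin.≤ j × DescentAt j)
    DescentFrom? i j = (i Fin.≤? j) ×-dec DescentAt? j

    descentsFrom : Fin m → ℕ
    descentsFrom i = length (filter (DescentFrom? i) (allFin m))

    indicator : (i j : Fin m) → ℕ
    indicator i j = if does (DescentFrom? i j) then 1 else 0

    descentsFrom-sum : ∀ i → descentsFrom i ≡ sumℕ (indicator i)
    descentsFrom-sum i = length-filter-tabulate (DescentFrom? i) (λ j → j)

  indicator-⇔ : ∀ {a b} {A : Set a} {B : Set b} (A? : Dec A) (B? : Dec B) → A ⇔ B →
                (if does A? then 1 else 0) ≡ (if does B? then 1 else 0)
  indicator-⇔ A? B? A⇔B = cong (if_then 1 else 0) (does-⇔ A⇔B A? B?)

  descentAt-tail : ∀ {m} (c : Vector (Fin r) (suc m)) σ j → DescentAt c σ (suc j) ⇔ DescentAt (tail c) (tail σ) j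
  descentAt-tail c σ j = mk⇔
    (λ { (suc i⁺ , e , D) → i⁺ , ℕ.suc-injective e , D })
    (λ { (i⁺ , e , D) → suc i⁺ , cong suc e , D })

  open Equivalence using (to; from)

  descentsFrom-suc : ∀ {m} (c : Vector (Fin r) (suc m)) σ i →
                     descentsFrom c σ (suc i) ≡ descentsFrom (tail c) (tail σ) i
  descentsFrom-suc {m} c σ i = trans (descentsFrom-sum c σ (suc i)) (trans
    (ℕ-Sum.sum-cong-≗ {m} (λ j → indicator-⇔ (DescentFrom? c σ (suc i) (suc j)) (DescentFrom? (tail c) (tail σ) i j)
      (mk⇔ (λ (i≤j , D) → ℕ.s≤s⁻¹ i≤j , to (descentAt-tail c σ j) D)
           (λ (i≤j , D) → ℕ.s≤s i≤j , from (descentAt-tail c σ j) D))))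
    (sym (descentsFrom-sum (tail c) (tail σ) i)))

  descentsFrom-zero : ∀ {m} (c : Vector (Fin r) (suc (suc m))) σ →
    descentsFrom c σ zero ≡
      descent (c zero) (c (suc zero)) (σ zero) (σ (suc zero)) + descentsFrom (tail c) (tail σ) zero
  descentsFrom-zero {m} c σ = trans (descentsFrom-sum c σ zero) (cong₂ _+_
    (indicator-⇔ (DescentFrom? c σ zero zero) (Descent? (c zero) (c (suc zero)) (σ zero) (σ (suc zero)))
      (mk⇔ (λ { (_ , suc zero , _ , D) → D }) (λ D → ℕ.z≤n , suc zero , refl , D)))
    (trans
      (ℕ-Sum.sum-cong-≗ {suc m} (λ j → indicator-⇔ (DescentFrom? c σ zero (suc j)) (DescentFrom? (tail c) (tail σ) zero j)
        (mk⇔ (λ (_ , D) → ℕ.z≤n , to (descentAt-tail c σ j) D)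
             (λ (_ , D) → ℕ.z≤n , from (descentAt-tail c σ j) D))))
      (sym (descentsFrom-sum (tail c) (tail σ) zero))))

  -- Passing from the tail to the whole vector adds at most one descent, at the new head, and one
  -- colour step; together they make up `gap`.
  minimum-formula : ∀ {m} (c : Vector (Fin r) (suc m)) σ i →
                    r * descentsFrom c σ i + colourSteps c i ≡ minimum c σ i
  minimum-formula {zero}  c σ zero = cong (_+ toℕ (c zero) % d)
    (trans (cong (r *_) (trans (descentsFrom-sum c σ zero) (trans (ℕ.+-identityʳ _) no-descent))) (ℕ.*-zeroʳ r))
    where
    no-descent : indicator c σ zero zero ≡ 0
    no-descent = cong (if_then 1 else 0) (dec-false (DescentFrom? c σ zero zero) λ { (_ , zero , () , _) })
  minimum-formula {suc m} c σ zero = trans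
    (cong (λ x → r * x + colourSteps c zero) (descentsFrom-zero c σ))
    (trans (rearrange r _ (descentsFrom (tail c) (tail σ) zero) (colourSteps (tail c) zero) _)
      (cong (_+ gap (c zero) (c (suc zero)) (σ zero) (σ (suc zero))) (minimum-formula (tail c) (tail σ) zero)))
    where
    rearrange : ∀ r b h k ε → r * (b + h) + (k + ε) ≡ r * h + k + (r * b + ε)
    rearrange = solve-∀
  minimum-formula {suc m} c σ (suc i) = trans
    (cong (λ x → r * x + colourSteps (tail c) i) (descentsFrom-suc c σ i))
    (minimum-formula (tail c) (tail σ) i)

  Λ-minimum : ∀ g i → Λ g i ≡ minimum (colours g) (places g) i
  Λ-minimum g = minimum-formula (colours g) (places g)

  fmaj-minimum : ∀ g → fmaj g ≡ sumℕ (minimum (colours g) (places g))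
  fmaj-minimum g = ℕ-Sum.sum-cong-≗ {suc n} (Λ-minimum g)

-- Products of weights as monomials.

module Monomials {c ℓ} (K : CommutativeRing c ℓ) (q a : CommutativeRing.Carrier K) where
  open RingLemmas K
  open SetoidReasoning setoid

  q^ : ∀ {m} → Vector ℕ m → Carrier
  q^ x = product (λ i → q ^ x i)

  product-split : ∀ {m} (x y : Vector ℕ m) → product (λ i → q ^ x i * a ^ y i) ≈ q^ x * a ^ sumℕ y
  product-split {zero}  x y = sym (*-identityˡ 1#)
  product-split {suc m} x y = begin
    q ^ x zero * a ^ y zero * product (λ i → q ^ tail x i * a ^ tail y i)
      ≈⟨ *-congˡ (product-split (tail x) (tail y)) ⟩
    q ^ x zero * a ^ y zero * (q^ (tail x) * a ^ sumℕ (tail y))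
      ≈⟨ solve 4 (λ A B C D → (A :* B) :* (C :* D) := (A :* C) :* (B :* D)) refl
           (q ^ x zero) (a ^ y zero) (q^ (tail x)) (a ^ sumℕ (tail y)) ⟩
    q ^ x zero * q^ (tail x) * (a ^ y zero * a ^ sumℕ (tail y))
      ≈⟨ *-congˡ (^-homo-* a (y zero) (sumℕ (tail y))) ⟨
    q^ x * a ^ sumℕ y ∎
    where open Solver using (solve; _:*_; _:=_)

  q^-sum : ∀ {m} (x : Vector ℕ m) → q^ x ≈ q ^ sumℕ x
  q^-sum {zero}  x = refl
  q^-sum {suc m} x = trans (*-congˡ (q^-sum (tail x))) (sym (^-homo-* q (x zero) (sumℕ (tail x))))

-- The theorem with its operations abstracted.  The operations of Defs and those of the ring PowerSeriesRing agree
-- definitionally, but converting the two instances into each other unfolds all products and takes exponential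
-- time; transporting along equalities of the operations avoids this.
record Identity {c ℓ} {A : Set c} {B : Set} (_≈_ : A → A → Set ℓ) (_+_ _*_ _-_ _÷_ : A → A → A) (1# : A)
  (_^_ : A → ℕ → A) ([_]⟨_⟩ : ℕ → A → A) (product : ∀ {n} → (Fin n → A) → A) (∑∞ : (ℕ → A) → A)
  (∑∈ : List B → (B → A) → A) (keep : A → A) (t q a : A)
  (Q R : ℕ → ℕ) (r d n : ℕ) (gs : List B) (fdes fmaj col : B → ℕ) : Set ℓ where
  field
    identity :
      keep (∑∞ (λ k → (t ^ k) *
        ((([ Q k ℕ.+ 1 ]⟨ q ^ d ⟩
           + (((a * q) * [ d ∸ 1 ]⟨ a * q ⟩) * [ Q k ]⟨ q ^ d ⟩))
          + ((a * (q ^ (Q k ℕ.* d ℕ.+ 1))) * [ R k ]⟨ a * q ⟩)) ^ n)))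
      ≈
      (∑∈ gs (λ g → ((t ^ fdes g) * (q ^ fmaj g)) * (a ^ col g))
        ÷ (((1# - t) * product {n ∸ 1} (λ j → 1# - ((t ^ r) * (q ^ ((toℕ j ℕ.+ 1) ℕ.* r)))))
            * (1# - ((t ^ d) * (q ^ (n ℕ.* d))))))

-- The identity over an arbitrary coefficient ring containing q and a.

module GeneratingFunctions (r p s n : ℕ) .{{r≢0 : NonZero r}} .{{s≢0 : NonZero s}}
  (p∣r : p ∣ r) (s∣r : s ∣ r) (ps∣rn : p ℕ.* s ∣ r ℕ.* suc n)
  {c ℓ} (K : CommutativeRing c ℓ) (q a : CommutativeRing.Carrier K) where

  open ColouredPermutationGroups r p s (suc n) s∣r hiding (h; k; Q; R)
  open Fibres r p s n p∣r s∣r ps∣rn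
  open RingLemmas K
  open BoxSums K
  open Monomials K q a
  open PowerSeriesRing K
  open Substitution powerSeriesRing t (const q) (φ q) (φ-isRingHomomorphism q) (φ-t q) (φ-const q q)
  open SetoidReasoning setoid

  -- The coefficient at `y` sums q^|x| over the chains x with first entry `y`. The progression leads
  -- from the old first entry to the new one, and `φ q` then charges q^y for it.
  chainSeries : ∀ {m} → Vector (Fin r) (suc m) → Vector (Fin (suc n)) (suc m) → ℕ → Carrier
  chainSeries {zero}  c σ = φ q (progression (toℕ (c zero) % d) d)
  chainSeries {suc m} c σ = φ q (chainSeries (tail c) (tail σ) S.*
    progression (gap (c zero) (c (suc zero)) (σ zero) (σ (suc zero))) r)

  chainSeries-* : ∀ {m} c σ → chainSeries {m} c σ S.* denominator r d (suc m) S.≈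
    t S.^ minimum c σ zero S.* const q S.^ sumℕ (minimum c σ)
  chainSeries-* {zero} c σ = S.trans {chainSeries c σ S.* denominator r d 1} {t S.^ b S.* const q S.^ b} {t S.^ b S.* const q S.^ (b ℕ.+ 0)}
    (φ-base r d {progression b d} {b} (progression-* b d))
    (λ k → reflexive (≡.cong (λ e → (t S.^ b S.* const q S.^ e) k) (≡.sym (ℕ.+-identityʳ b))))
    where b = toℕ (c zero) % d
  chainSeries-* {suc m} c σ =
    φ-step r d m {chainSeries (tail c) (tail σ)} {progression g r} {minimum (tail c) (tail σ) zero} {sumℕ (minimum (tail c) (tail σ))} {g}
      (chainSeries-* (tail c) (tail σ)) (progression-* g r)
    where g = gap (c zero) (c (suc zero)) (σ zero) (σ (suc zero))

  -- Chains decrease, so all entries after `y` are at most `y`, and every bound `b` above `y` gives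
  -- the same sum.
  boxSum-chain : ∀ {m} c σ {y b} → y ℕ.< b →
    boxSum b m (λ x → ⟦ Chain? {m} c σ (y Vector.∷ x) ⟧ * q^ (y Vector.∷ x)) ≈ chainSeries c σ y
  boxSum-chain {zero} c σ {y} _ = trans (*-comm _ _) (*-congʳ (*-identityʳ (q ^ y)))
  boxSum-chain {suc m} c σ {y} {b} y<b = begin
    sumUpTo b (λ z → boxSum b m (λ x → ⟦ Chain? c σ (y Vector.∷ z Vector.∷ x) ⟧ * q^ (y Vector.∷ z Vector.∷ x)))
      ≈⟨ sumUpTo-cong b peel ⟩
    sumUpTo b (λ z → q ^ y * (T z * ⟦ Step? z ⟧))
      ≈⟨ *-distribˡ-sum {b} (q ^ y) (λ z → T (toℕ z) * ⟦ Step? (toℕ z) ⟧) ⟨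
    q ^ y * sumUpTo b (λ z → T z * ⟦ Step? z ⟧)
      -- A step needs z ≤ y, so larger z contribute nothing; what is left is the Cauchy product with
      -- the progression.
      ≈⟨ *-congˡ (sumUpTo-truncate (λ z → T z * ⟦ Step? z ⟧) y<b (λ z y<z →
           trans (*-congˡ (reflexive (⟦⟧-no (Step? z) (λ (z≤y , _) → ℕ.<⇒≱ y<z z≤y)))) (zeroʳ (T z)))) ⟩
    q ^ y * sumUpTo (suc y) (λ z → T z * ⟦ Step? z ⟧)
      ≈⟨ *-congˡ (sumUpTo-cong (suc y) (λ z z≤y → *-congˡ {T z} (reflexive
           (⟦⟧-⇔ (Step? z) (mk⇔ proj₂ (ℕ.s≤s⁻¹ z≤y ,_)) (Progression? g r (y ∸ z)))))) ⟩
    chainSeries c σ y ∎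
    where
    g = gap (c zero) (c (suc zero)) (σ zero) (σ (suc zero))
    T = chainSeries (tail c) (tail σ)
    Step? : ∀ z → Dec (Step (c zero) (c (suc zero)) (σ zero) (σ (suc zero)) y z)
    Step? z = (z ℕ.≤? y) ×-dec Progression? g r (y ∸ z)
    open Solver using (solve; _:*_; _:=_)
    peel : ∀ z → z ℕ.< b →
      boxSum b m (λ x → ⟦ Chain? c σ (y Vector.∷ z Vector.∷ x) ⟧ * q^ (y Vector.∷ z Vector.∷ x)) ≈
      q ^ y * (T z * ⟦ Step? z ⟧)
    peel z z<b = begin
      boxSum b m (λ x → ⟦ Step? z ×-dec Chain? (tail c) (tail σ) (z Vector.∷ x) ⟧ * (q ^ y * q^ (z Vector.∷ x)))
        ≈⟨ boxSum-cong b m (λ x → trans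
             (*-congʳ (⟦⟧-× (Step? z) (Chain? (tail c) (tail σ) (z Vector.∷ x))))
             (solve 4 (λ A B C D → (A :* B) :* (C :* D) := (C :* A) :* (B :* D)) refl
               ⟦ Step? z ⟧ ⟦ Chain? (tail c) (tail σ) (z Vector.∷ x) ⟧ (q ^ y) (q^ (z Vector.∷ x)))) ⟩
      boxSum b m (λ x → q ^ y * ⟦ Step? z ⟧ * (⟦ Chain? (tail c) (tail σ) (z Vector.∷ x) ⟧ * q^ (z Vector.∷ x)))
        ≈⟨ *-distribˡ-boxSum b m (q ^ y * ⟦ Step? z ⟧) _ ⟨
      q ^ y * ⟦ Step? z ⟧ * boxSum b m (λ x → ⟦ Chain? (tail c) (tail σ) (z Vector.∷ x) ⟧ * q^ (z Vector.∷ x))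
        ≈⟨ *-congˡ (boxSum-chain (tail c) (tail σ) z<b) ⟩
      q ^ y * ⟦ Step? z ⟧ * T z
        ≈⟨ trans (*-assoc _ _ _) (*-congˡ (*-comm _ _)) ⟩
      q ^ y * (T z * ⟦ Step? z ⟧) ∎

  weightProduct : Vector ℕ (suc n) → Carrier
  weightProduct x = product (λ i → weight q a d (x i))

  product-cong-≗ : ∀ {m} (w : ℕ → Carrier) {x y : Vector ℕ m} → x ≗ y → product (w ∘ x) ≈ product (w ∘ y)
  product-cong-≗ {m} w e = product-cong {m} (λ i → reflexive (≡.cong w (e i)))

  fibreSeries : G[r,p,n] → ℕ → Carrier
  fibreSeries g k = boxSum (suc k) (suc n) (λ f → ⟦ Fibre? g f ⟧ * weightProduct f)

  -- The weight is symmetric in the coordinates, so f may be replaced by f ∘ σ. Summing over first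
  -- entries up to k is multiplication by `progression 0 1`, whose coefficients are all 1.
  fibreSeries-chain : ∀ g → fibreSeries g S.≈
    const (a ^ col g) S.* (chainSeries (colours g) (places g) S.* progression 0 1)
  fibreSeries-chain g k = begin
    boxSum b (suc n) (λ f → ⟦ Fibre? g f ⟧ * weightProduct f)
      ≈⟨ boxSum-cong b (suc n) permuted ⟩
    boxSum b (suc n) (λ f → v (f ∘ places g))
      ≈⟨ boxSum-permute b (suc n) v-extensional (perm (element g)) ⟨
    boxSum b (suc n) v
      ≈⟨ boxSum-cong b (suc n) monomial ⟩
    boxSum b (suc n) (λ x → a ^ col g * (⟦ chain? x ⟧ * q^ x))
      ≈⟨ *-distribˡ-boxSum b (suc n) (a ^ col g) (λ x → ⟦ chain? x ⟧ * q^ x) ⟨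
    a ^ col g * boxSum b (suc n) (λ x → ⟦ chain? x ⟧ * q^ x)
      ≈⟨ *-congˡ (sumUpTo-cong b (λ y y<b → trans (boxSum-chain (colours g) (places g) y<b)
           (sym (trans (*-congˡ (reflexive (⟦⟧-yes (Progression? 0 1 (k ∸ y)) (ℕ.z≤n , ∣.1∣ (k ∸ y))))) (*-identityʳ _))))) ⟩
    a ^ col g * (T S.* progression 0 1) k
      ≈⟨ constant-⊛ (a ^ col g) (T S.* progression 0 1) k ⟨
    (const (a ^ col g) S.* (T S.* progression 0 1)) k ∎
    where
    b = suc k
    T = chainSeries (colours g) (places g)
    chain? = Chain? (colours g) (places g)
    v : Vector ℕ (suc n) → Carrier
    v x = ⟦ chain? x ⟧ * weightProduct x
    permuted : ∀ f → ⟦ Fibre? g f ⟧ * weightProduct f ≈ v (f ∘ places g)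
    permuted f = *-congˡ {⟦ Fibre? g f ⟧} (product-permute (weight q a d ∘ f) (perm (element g)))
    monomial : ∀ x → v x ≈ a ^ col g * (⟦ chain? x ⟧ * q^ x)
    monomial x = begin
      ⟦ chain? x ⟧ * weightProduct x
        ≈⟨ ⟦⟧-*-cong (chain? x) (λ chain → trans
             (product-cong {suc n} (λ i → *-congˡ {q ^ x i} (^-congʳ a (chain⇒residue {σ = places g} chain i))))
             (product-split x (λ i → toℕ (colours g i) % d))) ⟩
      ⟦ chain? x ⟧ * (q^ x * a ^ col g)
        ≈⟨ trans (sym (*-assoc _ _ _)) (*-comm _ _) ⟩
      a ^ col g * (⟦ chain? x ⟧ * q^ x) ∎
    v-extensional : Extensional v
    v-extensional {x} {y} e = *-cong
      (reflexive (⟦⟧-⇔ (chain? x) (mk⇔ (chain-resp-≗ (colours g) (places g) e)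
         (chain-resp-≗ (colours g) (places g) (≡.sym ∘ e))) (chain? y)))
      (product-cong-≗ (weight q a d) e)

  fibreSeries-* : ∀ g → fibreSeries g S.* ((S.1# S.- t) S.* denominator r d (suc n)) S.≈
    t S.^ fdes g S.* const q S.^ fmaj g S.* const (a ^ col g)
  fibreSeries-* g k = begin
    (fibreSeries g S.* (U S.* D)) k
      ≈⟨ S.*-congʳ {U S.* D} {fibreSeries g} {A S.* (T S.* P)} (fibreSeries-chain g) k ⟩
    (A S.* (T S.* P) S.* (U S.* D)) k
      ≈⟨ S.Solver.solve 5 (λ A T P U D → A :* (T :* P) :* (U :* D) := T :* D :* (P :* U) :* A) (λ _ → refl) A T P U D k ⟩
    (T S.* D S.* (P S.* U) S.* A) k
      ≈⟨ S.*-congʳ {A} {T S.* D S.* (P S.* U)} {M S.* S.1#} (S.*-cong {T S.* D} {M} {P S.* U} {S.1#} TD PU) k ⟩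
    (M S.* S.1# S.* A) k
      ≈⟨ S.*-congʳ {A} {M S.* S.1#} {M} (S.*-identityʳ M) k ⟩
    (M S.* A) k ∎
    where
    open S.Solver using (_:*_; _:=_)
    A = const (a ^ col g)
    T = chainSeries (colours g) (places g)
    P = progression 0 1
    U = S.1# S.- t
    D = denominator r d (suc n)
    M = t S.^ fdes g S.* const q S.^ fmaj g
    TD : T S.* D S.≈ M
    TD j = trans (chainSeries-* (colours g) (places g) j) (reflexive (≡.cong₂ (λ u v → (t S.^ u S.* const q S.^ v) j)
      (≡.sym (Λ-minimum g zero)) (≡.sym (fmaj-minimum g))))
    PU : P S.* U S.≈ S.1#
    PU = S.trans {P S.* U} {P S.* (S.1# S.- t S.^ 1)} {S.1#}
      (S.*-congˡ {P} {U} {S.1# S.- t S.^ 1} (S.-‿congˡ {t} {t S.^ 1} {S.1#} (S.sym {t S.* S.1#} {t} (S.*-identityʳ t))))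
      (progression-* 0 1)

  -- Existence and uniqueness of the class give one representative if `p` divides the sum; otherwise
  -- every fibre misses `f`.
  sum-fibres : ∀ f → sumList representatives (λ g → ⟦ Fibre? g f ⟧) ≈ ⟦ p ∣? sumℕ f ⟧
  sum-fibres f = decide (p ∣? sumℕ f)
    where
    fibre? = λ g → Fibre? g f
    decide : (D : Dec (p ∣ sumℕ f)) → sumList representatives (λ g → ⟦ Fibre? g f ⟧) ≈ ⟦ D ⟧
    decide (yes p∣f) = let g , fibre = fibre-exists f p∣f in
      sumList-⟦⟧-unique fibre? representatives-unique (λ {g} {h} → fibre-unique {g} {h} f)
        (Any.map (λ {h} g∼h → fibre-resp-∼ {g} {h} f g∼h fibre) (representatives-complete g))
    decide (no ¬p∣f) = sumList-⟦⟧-zero {_~_ = _∼_} fibre? {representatives} (All.tabulate (λ {g} _ fibre → ¬p∣f (fibre⇒p∣sum g f fibre)))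

  sum-fibreSeries : ∀ k → boxSum (suc k) (suc n) (λ f → ⟦ p ∣? sumℕ f ⟧ * weightProduct f) ≈
                    S.sumList representatives fibreSeries k
  sum-fibreSeries k = begin
    boxSum (suc k) (suc n) (λ f → ⟦ p ∣? sumℕ f ⟧ * weightProduct f)
      ≈⟨ boxSum-cong (suc k) (suc n) (λ f → trans (*-congʳ (sym (sum-fibres f)))
           (*-distribʳ-sumList representatives (λ g → ⟦ Fibre? g f ⟧) (weightProduct f))) ⟩
    boxSum (suc k) (suc n) (λ f → sumList representatives (λ g → ⟦ Fibre? g f ⟧ * weightProduct f))
      ≈⟨ boxSum-sumList (suc k) (suc n) representatives (λ f g → ⟦ Fibre? g f ⟧ * weightProduct f) ⟩
    sumList representatives (λ g → fibreSeries g k)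
      ≡⟨ coeff-sumList representatives fibreSeries k ⟨
    S.sumList representatives fibreSeries k ∎

  sum-fibreSeries-* : S.sumList representatives fibreSeries S.* ((S.1# S.- t) S.* denominator r d (suc n)) S.≈
    S.sumList representatives (λ g → t S.^ fdes g S.* const q S.^ fmaj g S.* const a S.^ col g)
  sum-fibreSeries-* = S.trans
    {S.sumList representatives fibreSeries S.* D}
    {S.sumList representatives (λ g → fibreSeries g S.* D)}
    {S.sumList representatives (λ g → t S.^ fdes g S.* const q S.^ fmaj g S.* const a S.^ col g)}
    (S.*-distribʳ-sumList representatives fibreSeries D)
    (S.sumList-cong representatives (λ g k → trans (fibreSeries-* g k)
      (S.*-congˡ {t S.^ fdes g S.* const q S.^ fmaj g} {const (a ^ col g)} {const a S.^ col g} (const-^ a (col g)) k)))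
    where D = (S.1# S.- t) S.* denominator r d (suc n)

  geometricQuotient : (F D : ℕ → Carrier) → ℕ → Carrier
  geometricQuotient F D = F S.* ((S.1# S.- D) ^∞)

  bracket : ℕ → (ℕ → Carrier) → ℕ → Carrier
  bracket m F = S.sum {m} (λ i → F S.^ toℕ i)

  powers : ℕ → Carrier
  powers = Defs.infiniteSum rawRing (λ k → t S.^ k S.*
    (bracket (k / d ℕ.+ 1) (const q S.^ d)
     S.+ const a S.* const q S.* bracket (d ∸ 1) (const a S.* const q) S.* bracket (k / d) (const q S.^ d)
     S.+ const a S.* const q S.^ (k / d ℕ.* d ℕ.+ 1) S.* bracket (k % d) (const a S.* const q)) S.^ suc n)

  quotient : ℕ → Carrier
  quotient = geometricQuotient
    (S.sumList representatives (λ g → t S.^ fdes g S.* const q S.^ fmaj g S.* const a S.^ col g))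
    ((S.1# S.- t)
     S.* S.product {n} (λ j → S.1# S.- t S.^ r S.* const q S.^ ((toℕ j ℕ.+ 1) ℕ.* r))
     S.* (S.1# S.- t S.^ d S.* const q S.^ (suc n ℕ.* d)))

  sum-fibreSeries-÷ : S.sumList representatives fibreSeries S.≈ quotient
  sum-fibreSeries-÷ = S.*≈⇒≈* {F} {D} {N} {(S.1# S.- D) ^∞}
    (λ k → trans (S.*-congˡ {F} {D} {U S.* (P S.* V)} (S.*-assoc U P V) k) (sum-fibreSeries-* k))
    (inverse D D-head)
    where
    F = S.sumList representatives fibreSeries
    N = S.sumList representatives (λ g → t S.^ fdes g S.* const q S.^ fmaj g S.* const a S.^ col g)
    U = S.1# S.- t
    P = S.product {n} (λ j → S.1# S.- t S.^ r S.* const q S.^ ((toℕ j ℕ.+ 1) ℕ.* r))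
    V = S.1# S.- t S.^ d S.* const q S.^ (suc n ℕ.* d)
    D = U S.* P S.* V
    -- Since `r` and `d` are nonzero, every factor is 1 modulo t, as needed for `^∞` to yield the
    -- reciprocal.
    D-head : D 0 ≈ 1#
    D-head = head-* {U S.* P} {V}
      (head-* {U} {P} 1-0≈1
        (head-product {n} _ (λ j → head-1-t^ r (const q S.^ ((toℕ j ℕ.+ 1) ℕ.* r)))))
      (head-1-t^ d (const q S.^ (suc n ℕ.* d)))

  const-weight : ∀ x → BoxSums.weight powerSeriesRing (const q) (const a) d x S.≈ const (weight q a d x)
  const-weight x = S.trans
    {const q S.^ x S.* const a S.^ (x % d)} {const (q ^ x) S.* const (a ^ (x % d))} {const (weight q a d x)}
    (S.*-cong {const q S.^ x} {const (q ^ x)} {const a S.^ (x % d)} {const (a ^ (x % d))}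
      (λ k → sym (const-^ q x k)) (λ k → sym (const-^ a (x % d) k)))
    (λ k → sym (const-* (q ^ x) (a ^ (x % d)) k))

  -- The base of the k-th term does not involve t, so neither does its n-th power, and only k = i
  -- reaches degree i. Expanding that power gives one term for each vector in the box.
  powers-boxSum : powers S.≈ λ k → boxSum (suc k) (suc n) weightProduct
  powers-boxSum i = trans
    (∑∞-t^-const {f = λ k → sumUpTo (suc k) (weight q a d) ^ suc n} (λ k j → trans
      (S.^-congˡ (suc n) {y = const (sumUpTo (suc k) (weight q a d))} (λ j → trans
        (BoxSums.sum-weight powerSeriesRing (const q) (const a) d k j)
        (trans (S.sumUpTo-cong (suc k) {g = const ∘ weight q a d} (λ x _ → const-weight x) j)
               (sym (const-sum {suc k} (weight q a d ∘ toℕ) j)))) j)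
      (sym (const-^ (sumUpTo (suc k) (weight q a d)) (suc n) j))) i)
    (^-sumUpTo (suc i) (suc n) (weight q a d))

  -- The extraction enters only through additivity and its effect on weights, so `K` can stay an
  -- arbitrary ring here.
  module _ (keep : Carrier → Carrier) (keep-cong : ∀ {x y} → x ≈ y → keep x ≈ keep y)
    (keep-sum : ∀ {m} (f : Fin m → Carrier) → keep (sum f) ≈ sum (keep ∘ f))
    (keep-weight : ∀ f → keep (weightProduct f) ≈ ⟦ p ∣? sumℕ f ⟧ * weightProduct f) where

    keep-powers : (keep ∘ powers) S.≈ quotient
    keep-powers k = begin
      keep (powers k)
        ≈⟨ keep-cong (powers-boxSum k) ⟩
      keep (boxSum (suc k) (suc n) weightProduct)
        ≈⟨ boxSum-homomorphic keep-cong keep-sum (suc k) (suc n) weightProduct ⟩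
      boxSum (suc k) (suc n) (keep ∘ weightProduct)
        ≈⟨ boxSum-cong (suc k) (suc n) keep-weight ⟩
      boxSum (suc k) (suc n) (λ f → ⟦ p ∣? sumℕ f ⟧ * weightProduct f)
        ≈⟨ sum-fibreSeries k ⟩
      S.sumList representatives fibreSeries k
        ≈⟨ sum-fibreSeries-÷ k ⟩
      quotient k ∎

    -- `keep′` is matched only up to the equality of series: the theorem extracts by a conditional,
    -- `keep` here by multiplying with an indicator.
    identity-transport : ∀ {_≈′_ : (ℕ → Carrier) → (ℕ → Carrier) → Set ℓ} {_+′_ _*′_ _-′_ _÷′_ 1′ _^′_ [_]′⟨_⟩}
      {product′ : ∀ {m} → (Fin m → ℕ → Carrier) → ℕ → Carrier} {∑∞′ ∑∈′ keep′ t′ q′ a′ Q′ R′ d′ gs fdes′ fmaj′ col′} →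
      S._≈_ ≡ _≈′_ → S._+_ ≡ _+′_ → S._*_ ≡ _*′_ → S._-_ ≡ _-′_ → geometricQuotient ≡ _÷′_ → S.1# ≡ 1′ →
      S._^_ ≡ _^′_ → bracket ≡ [_]′⟨_⟩ → (λ {m} → S.product {m}) ≡ (λ {m} → product′ {m}) →
      Defs.infiniteSum rawRing ≡ ∑∞′ → S.sumList ≡ ∑∈′ → (∀ F → keep′ F S.≈ keep ∘ F) →
      t ≡ t′ → const q ≡ q′ → const a ≡ a′ → (_/ d) ≡ Q′ → (_% d) ≡ R′ → d ≡ d′ →
      representatives ≡ gs → fdes ≡ fdes′ → fmaj ≡ fmaj′ → col ≡ col′ →
      Identity _≈′_ _+′_ _*′_ _-′_ _÷′_ 1′ _^′_ [_]′⟨_⟩ (λ {m} → product′ {m}) ∑∞′ ∑∈′ keep′ t′ q′ a′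
        Q′ R′ r d′ (suc n) gs fdes′ fmaj′ col′
    identity-transport ≡.refl ≡.refl ≡.refl ≡.refl ≡.refl ≡.refl ≡.refl ≡.refl ≡.refl ≡.refl ≡.refl keep′≈
      ≡.refl ≡.refl ≡.refl ≡.refl ≡.refl ≡.refl ≡.refl ≡.refl ≡.refl ≡.refl =
      record { identity = λ k → trans (keep′≈ powers k) (keep-powers k) }

-- Extraction of the degrees divisible by p.

module KeepMultiples {c ℓ} (L : CommutativeRing c ℓ) (x : CommutativeRing.Carrier L)
  (p d : ℕ) .{{d≢0 : NonZero d}} where
  open PowerSeriesRing L using (powerSeriesRing; keepMultiples; keepMultiples-sum; keepMultiples-monomial; const; const-^)
    renaming (t to u)
  module L = RingLemmas L
  module K = RingLemmas powerSeriesRing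
  open BoxSums powerSeriesRing
  open Monomials powerSeriesRing u (const x)

  product-weight : ∀ {n} (f : Vector ℕ n) →
    K.product (weight u (const x) d ∘ f) K.≈ u K.^ sumℕ f K.* const (x L.^ sumℕ (λ i → f i % d))
  product-weight f = K.trans {K.product (weight u (const x) d ∘ f)} {q^ f K.* const x K.^ m} {u K.^ sumℕ f K.* const (x L.^ m)}
    (product-split f (λ i → f i % d))
    (K.*-cong {q^ f} {u K.^ sumℕ f} {const x K.^ m} {const (x L.^ m)} (q^-sum f) (λ k → L.sym (const-^ x m k)))
    where m = sumℕ (λ i → f i % d)

  -- The weight of `f` is a monomial of degree `sumℕ f` in the variable, so the extraction keeps it
  -- whole or kills it.
  keepMultiples-weight : ∀ {n} (f : Vector ℕ n) →
    keepMultiples p (K.product (weight u (const x) d ∘ f)) K.≈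
    K.⟦ p ∣? sumℕ f ⟧ K.* K.product (weight u (const x) d ∘ f)
  keepMultiples-weight f k = L.trans (L.*-congˡ {L.⟦ p ∣? k ⟧} (product-weight f k)) (L.trans
    (keepMultiples-monomial p (sumℕ f) (x L.^ sumℕ (λ i → f i % d)) k)
    (K.*-congˡ {K.⟦ p ∣? sumℕ f ⟧} {u K.^ sumℕ f K.* const (x L.^ sumℕ (λ i → f i % d))} {K.product (weight u (const x) d ∘ f)}
      (λ j → L.sym (product-weight f j)) k))

-- Specialisation to integer power series in t, q and a.

module ℤ[[a]]-Ring = PowerSeriesRing ℤ.+-*-commutativeRing
module ℤ[[q,a]]-Ring = PowerSeriesRing ℤ[[a]]-Ring.powerSeriesRing

K = ℤ[[q,a]]-Ring.powerSeriesRing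

open Defs
open SeriesOperations

⟪⟫-keepMultiples : ∀ F p i j l → (⟪ F ⟫q^ p) i j l ≡ ℤ[[q,a]]-Ring.keepMultiples p (F i) j l
⟪⟫-keepMultiples F p i j l = cases (does (p ∣? j))
  where
  module R = RingLemmas ℤ[[a]]-Ring.powerSeriesRing
  cases : ∀ b → (if b then F i j l else 0ℤ) ≡ ((if b then R.1# else R.0#) R.* F i j) l
  cases true  = ≡.sym (R.*-identityˡ (F i j) l)
  cases false = ≡.sym (R.zeroˡ (F i j) l)

series-identity : (r p s n : ℕ) .{{r≢0 : NonZero r}} .{{s≢0 : NonZero s}} .{{n≢0 : NonZero n}} →
    p ∣ r → (s∣r : s ∣ r) → p ℕ.* s ∣ r ℕ.* n →
    let open ColouredPermutationGroups r p s n s∣r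
        d = r / s
    in Identity _≈_ _+_ _*_ _-_ _÷_ 1# _^_ [_]⟨_⟩ (λ {m} → product {m}) ∑∞ (∑∈ {B = G[r,p,n]}) (⟪_⟫q^ p) t q a
         Q R r d n representatives fdes fmaj col
series-identity r p s (suc n) p∣r s∣r ps∣rn =
  GeneratingFunctions.identity-transport r p s n p∣r s∣r ps∣rn K ℤ[[q,a]]-Ring.t (ℤ[[q,a]]-Ring.const ℤ[[a]]-Ring.t)
    (ℤ[[q,a]]-Ring.keepMultiples p) (λ {x} {y} e j → L.*-congˡ {L.⟦ p ∣? j ⟧} (e j)) (ℤ[[q,a]]-Ring.keepMultiples-sum p)
    (KeepMultiples.keepMultiples-weight ℤ[[a]]-Ring.powerSeriesRing ℤ[[a]]-Ring.t p (r / s))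
    ≡.refl ≡.refl ≡.refl ≡.refl ≡.refl ≡.refl ≡.refl ≡.refl ≡.refl ≡.refl ≡.refl (λ F → ⟪⟫-keepMultiples F p)
    ≡.refl ≡.refl ≡.refl ≡.refl ≡.refl ≡.refl ≡.refl ≡.refl ≡.refl ≡.refl
  where
  module L = RingLemmas ℤ[[a]]-Ring.powerSeriesRing
  instance
    d≢0 : NonZero (r / s)
    d≢0 = r/s≢0 r s s∣r

theorem5p4 : (r p s n : ℕ) .{{_ : NonZero r}} .{{_ : NonZero p}} .{{_ : NonZero s}} .{{_ : NonZero n}} →
    p ∣ r → (s∣r : s ∣ r) → p ℕ.* s ∣ r ℕ.* n →
    let open ColouredPermutationGroups r p s n s∣r
        d = r / s
    in
    ⟪ ∑∞ (λ k → t ^ k *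
         ([ Q k ℕ.+ 1 ]⟨ q ^ d ⟩
          + a * q * [ d ∸ 1 ]⟨ a * q ⟩ * [ Q k ]⟨ q ^ d ⟩
          + a * q ^ (Q k ℕ.* d ℕ.+ 1) * [ R k ]⟨ a * q ⟩) ^ n) ⟫q^ p
    ≈
    (∑[ g ∈ representatives ] (t ^ fdes g * q ^ fmaj g * a ^ col g))
      ÷ ((1# - t)
         * product {n ∸ 1} (λ j → 1# - t ^ r * q ^ ((toℕ j ℕ.+ 1) ℕ.* r))
         * (1# - t ^ d * q ^ (n ℕ.* d)))
theorem5p4 r p s n p∣r s∣r ps∣rn = Identity.identity (series-identity r p s n p∣r s∣r ps∣rn)
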